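{- Let $q=p^s$ where $p$ is an odd prime and $s\geq 1$ is an integer, let $H=\{x^2\mid x\in\mathbb{F}_q^*\}$ be the set of nonzero squares (quadratic residues) in $\mathbb{F}_q$, and let $k$ be an integer with $1\leq k\leq |H|=\frac{q-1}{2}$. Let $b\in\mathbb{F}_q^*$ and let $N_H(k,b)$ be the number of $k$-element subsets $S\subseteq H$ with $\sum_{a\in S}a=b$. (1) If either $p\equiv 1 \pmod 4$, or $p\equiv 3\pmod 4$ and $s$ is even, then $$N_H(k,b)=\frac{1}{q}\binom{\frac{q-1}{2}}{k}-\frac{(-1)^k}{2q\,k!}\Big\{(1-\sqrt{q})A_{k,b}\Big(\tfrac{1-\sqrt{q}}{2},\tfrac{1+\sqrt{q}}{2},\tfrac{1-q}{2}\Big)+(1+\sqrt{q})A_{k,b}\Big(\tfrac{1+\sqrt{q}}{2},\tfrac{1-\sqrt{q}}{2},\tfrac{1-q}{2}\Big)\Big\}.$$ (2) If $p\equiv 3\pmod 4$ and $s$ is odd, then $$N_H(k,b)=\frac{1}{q}\binom{\frac{q-1}{2}}{k}-\frac{(-1)^k}{2q\,k!}\Big\{(1+\sqrt{q}i)A_{k,b}\Big(\tfrac{1-\sqrt{q}i}{2},\tfrac{1+\sqrt{q}i}{2},\tfrac{1-q}{2}\Big)+(1-\sqrt{q}i)A_{k,b}\Big(\tfrac{1+\sqrt{q}i}{2},\tfrac{1-\sqrt{q}i}{2},\tfrac{1-q}{2}\Big)\Big\},$$ where $i=\sqrt{ -1}$.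
   Context: $\chi$ denotes the quadratic character of $\mathbb{F}_q^*$ ($\chi(x)=1$ if $x$ is a nonzero square, $-1$ otherwise), and for an integer $j$, $\chi(j)$ means $\chi$ evaluated at the image of $j$ in $\mathbb{F}_q$. For integers $c_1,\dots,c_k\geq 0$ with $\sum_{j} jc_j=k$, let $N(c_1,\dots,c_k)=\frac{k!}{1^{c_1}c_1!\,2^{c_2}c_2!\cdots k^{c_k}c_k!}$ (the number of permutations in $S_k$ with exactly $c_j$ cycles of length $j$ for each $j$). For $b\in\mathbb{F}_q^*$ and complex numbers $u,v,w$, define $$A_{k,b}(u,v,w)=\sum_{c_1,\dots,c_k\ge 0,\ \sum_j jc_j=k}N(c_1,\dots,c_k)\,t_1^{c_1}t_2^{c_2}\cdots t_k^{c_k},$$ where $t_j=u$ if $p\nmid j$ and $\chi(j)=\chi(b)$; $t_j=v$ if $p\nmid j$ and $\chi(j)=-\chi(b)$; $t_j=w$ if $p\mid j$. For real $x$ and integer $j\ge0$, $\binom{x}{j}=x(x-1)\cdots(x-j+1)/j!$. -}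

module Defs where

open import Data.Nat as ℕ using (ℕ; zero; suc; _≤_; _∸_; _!; _^_)
open import Data.Nat.Divisibility using (_∣?_)
open import Data.Nat.Combinatorics using (_C_)
open import Data.Nat.ListAction using (sum; product)
open import Data.Nat.DivMod using (_/_)
open import Data.Integer as ℤ using (ℤ; +_)
open import Data.Rational as ℚ using (ℚ; 0ℚ; 1ℚ)
open import Data.Fin using (Fin; toℕ)
open import Data.Fin.Subset using (Subset; _∈_; ∣_∣)
open import Data.Fin.Subset.Properties using (_∈?_)
open import Data.Vec as Vec using (Vec; []; _∷_)
open import Data.List as List using (List; []; _∷_; filter; length; allFin; concatMap)
open import Data.Bool using (Bool; true; false; if_then_else_)
open import Data.Product using (Σ; _×_; _,_; proj₁; proj₂; ∃-syntax)
open import Relation.Nullary using (¬_; Dec; yes; no; does)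
open import Relation.Nullary.Decidable using (_×-dec_)
open import Relation.Binary.PropositionalEquality using (_≡_; _≢_)
open import Data.Fin.Properties using () renaming (_≟_ to _≟F_)
open import Data.List.Relation.Unary.Any using (any?)
open import Algebra.Structures using (IsCommutativeRing)

-- Finite fields with q elements, carrier literally Fin q.
-- (Every field with q elements is isomorphic to one of these.)

record FiniteField (q : ℕ) : Set where
  field
    _+_ _*_ : Fin q → Fin q → Fin q
    -_      : Fin q → Fin q
    0# 1#   : Fin q
    isCommutativeRing : IsCommutativeRing _≡_ _+_ _*_ -_ 0# 1#
    0≢1     : 0# ≢ 1#
    inverse : ∀ x → x ≢ 0# → ∃[ y ] (x * y ≡ 1#)

module _ {q : ℕ} (F : FiniteField q) where
  open FiniteField F

  ι : ℕ → Fin q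
  ι zero    = 0#
  ι (suc n) = 1# + ι n

  IsNonzeroSquare : Fin q → Set
  IsNonzeroSquare x = (x ≢ 0#) × (∃[ y ] (y * y ≡ x))

  isNonzeroSquare? : (x : Fin q) → Dec (IsNonzeroSquare x)
  isNonzeroSquare? x with x ≟F 0#
  ... | yes x≡0 = no (λ p → proj₁ p x≡0)
  ... | no x≢0 with any? (λ y → (y * y) ≟F x) (allFin q)
  ...   | yes a = yes (x≢0 , witness a)
    where
    open import Data.List.Relation.Unary.Any using (Any; here; there)
    witness : ∀ {xs : List (Fin q)} → Any (λ y → y * y ≡ x) xs → ∃[ y ] (y * y ≡ x)
    witness (here {y} e) = y , e
    witness (there a)    = witness a
  ...   | no na = no (λ p → na (lemma (proj₂ p)))
    where
    open import Data.List.Relation.Unary.Any using (Any; here; there)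
    open import Data.List.Membership.Propositional.Properties using (∈-allFin)
    open import Data.List.Relation.Unary.Any.Properties using (lookup-result)
    open import Data.List.Membership.Propositional using () renaming (_∈_ to _∈L_)
    open import Data.List.Membership.Propositional.Properties using (∈-lookup)
    open import Relation.Binary.PropositionalEquality using (subst)
    lemma : ∃[ y ] (y * y ≡ x) → Any (λ y → y * y ≡ x) (allFin q)
    lemma (y , e) = Data.List.Relation.Unary.Any.map (λ { refl → e }) (∈-allFin y)
      where open import Relation.Binary.PropositionalEquality using (refl)
            import Data.List.Relation.Unary.Any

  -- quadratic character χ : F_q^* → {±1} (χ 0 = -1 is never used)
  χ : Fin q → ℤ
  χ x = if does (isNonzeroSquare? x) then + 1 else ℤ.- (+ 1)

  subsetSum : Subset q → Fin q
  subsetSum S = List.foldr (λ a acc → if does (a ∈? S) then a + acc else acc) 0# (allFin q)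

  ⊆H? : (S : Subset q) → Dec (∀ a → a ∈ S → IsNonzeroSquare a)
  ⊆H? S = Data.Fin.Properties.all? (λ a → Data.Fin.Subset.Properties._∈?_ a S →-dec isNonzeroSquare? a)
    where import Data.Fin.Properties
          import Data.Fin.Subset.Properties
          open import Relation.Nullary.Decidable using (_→-dec_)

allSubsets : (n : ℕ) → List (Subset n)
allSubsets zero    = [] ∷ []
allSubsets (suc n) = concatMap (λ s → (false ∷ s) ∷ (true ∷ s) ∷ []) (allSubsets n)

N-H : {q : ℕ} → FiniteField q → ℕ → Fin q → ℕ
N-H {q} F k b = length (filter P? (allSubsets q))
  where
  P? : (S : Subset q) → Dec ((∣ S ∣ ≡ k) × ((∀ a → a ∈ S → IsNonzeroSquare F a) × (subsetSum F S ≡ b)))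
  P? S = (∣ S ∣ ℕ.≟ k) ×-dec (⊆H? F S ×-dec (subsetSum F S ≟F b))

-- The ring ℚ(√D) = ℚ[X]/(X² − D), elements a + b√D as pairs.

infix 5 _+√·_
record ℚ[√_] (D : ℤ) : Set where
  constructor _+√·_
  field
    re : ℚ
    im : ℚ

module _ {D : ℤ} where
  infixl 6 _⊕_ _⊖_
  infixl 7 _⊗_
  _⊕_ : ℚ[√ D ] → ℚ[√ D ] → ℚ[√ D ]
  (a +√· b) ⊕ (c +√· d) = (a ℚ.+ c) +√· (b ℚ.+ d)

  ⊝_ : ℚ[√ D ] → ℚ[√ D ]
  ⊝ (a +√· b) = ℚ.- a +√· ℚ.- b

  _⊖_ : ℚ[√ D ] → ℚ[√ D ] → ℚ[√ D ]
  x ⊖ y = x ⊕ ⊝ y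

  _⊗_ : ℚ[√ D ] → ℚ[√ D ] → ℚ[√ D ]
  (a +√· b) ⊗ (c +√· d) =
    (a ℚ.* c ℚ.+ (D ℚ./ 1) ℚ.* b ℚ.* d) +√· (a ℚ.* d ℚ.+ b ℚ.* c)

  embed : ℚ → ℚ[√ D ]
  embed r = r +√· 0ℚ

  √D : ℚ[√ D ]
  √D = 0ℚ +√· 1ℚ

  _^^_ : ℚ[√ D ] → ℕ → ℚ[√ D ]
  x ^^ zero  = embed 1ℚ
  x ^^ suc n = x ⊗ (x ^^ n)

-- 1/n as a rational (n ≥ 1 in every use below; 1/0 := 0 is never used)
recip : ℕ → ℚ
recip zero    = 0ℚ
recip (suc n) = + 1 ℚ./ suc n

allVecs : (n m : ℕ) → List (Vec ℕ n)
allVecs zero    m = [] ∷ []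
allVecs (suc n) m = concatMap (λ c → List.map (c ∷_) (allVecs n m)) (List.upTo m)

-- weight Σ_j j c_j of (c_1,…,c_n) (index i : Fin n stands for j = toℕ i + 1)
weight : {n : ℕ} → Vec ℕ n → ℕ
weight {n} c = sum (List.map (λ i → suc (toℕ i) ℕ.* Vec.lookup c i) (allFin n))

cycleTypes : (k : ℕ) → List (Vec ℕ k)
cycleTypes k = filter (λ c → weight c ℕ.≟ k) (allVecs k (suc k))

Ncount : {k : ℕ} → Vec ℕ k → ℚ
Ncount {k} c = (+ (k !) ℚ./ 1) ℚ.*
  recip (product (List.map (λ i → (suc (toℕ i) ^ Vec.lookup c i) ℕ.* (Vec.lookup c i !)) (allFin k)))

module _ {q : ℕ} (F : FiniteField q) (p : ℕ) where

  tval : {D : ℤ} → Fin q → (u v w : ℚ[√ D ]) → ℕ → ℚ[√ D ]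
  tval b u v w j with p ∣? j
  ... | yes _ = w
  ... | no  _ = if does (χ F (ι F j) ℤ.≟ χ F b) then u else v

  A : {D : ℤ} (k : ℕ) → Fin q → (u v w : ℚ[√ D ]) → ℚ[√ D ]
  A {D} k b u v w = List.foldr _⊕_ (embed 0ℚ) (List.map term (cycleTypes k))
    where
    term : Vec ℕ k → ℚ[√ D ]
    term c = embed (Ncount c) ⊗
      List.foldr _⊗_ (embed 1ℚ)
        (List.map (λ i → tval b u v w (suc (toℕ i)) ^^ Vec.lookup c i) (allFin k))

half : ℚ
half = recip 2

sgn : ℕ → ℚ
sgn zero    = 1ℚ
sgn (suc k) = ℚ.- sgn k

mainTerm : ℕ → ℕ → ℚ
mainTerm q k = recip q ℚ.* (+ (((q ∸ 1) / 2) C k) ℚ./ 1)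

coef : ℕ → ℕ → ℚ
coef q k = sgn k ℚ.* recip (2 ℕ.* q ℕ.* (k !))

wval : (D : ℤ) → ℕ → ℚ[√ D ]
wval D q = embed ((+ 1 ℤ.- + q) ℚ./ 2)

RHS₁ : {q : ℕ} → FiniteField q → (p k : ℕ) → Fin q → ℚ[√ (+ q) ]
RHS₁ {q} F p k b =
  embed (mainTerm q k) ⊖ embed (coef q k) ⊗
    ( (one ⊖ √D) ⊗ A F p k b (h ⊗ (one ⊖ √D)) (h ⊗ (one ⊕ √D)) w
    ⊕ (one ⊕ √D) ⊗ A F p k b (h ⊗ (one ⊕ √D)) (h ⊗ (one ⊖ √D)) w )
  where
  one h w : ℚ[√ (+ q) ]
  one = embed 1ℚ
  h   = embed half
  w   = wval (+ q) q

-- Case (2): D = −q, √D = √q·i.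
RHS₂ : {q : ℕ} → FiniteField q → (p k : ℕ) → Fin q → ℚ[√ (ℤ.- + q) ]
RHS₂ {q} F p k b =
  embed (mainTerm q k) ⊖ embed (coef q k) ⊗
    ( (one ⊕ √D) ⊗ A F p k b (h ⊗ (one ⊖ √D)) (h ⊗ (one ⊕ √D)) w
    ⊕ (one ⊖ √D) ⊗ A F p k b (h ⊗ (one ⊕ √D)) (h ⊗ (one ⊖ √D)) w )
  where
  one h w : ℚ[√ (ℤ.- + q) ]
  one = embed 1ℚ
  h   = embed half
  w   = wval (ℤ.- + q) q

{-# OPTIONS --safe #-}
module Submission where

open import Defs
open import Algebra.Bundles using (CommutativeMonoid; CommutativeRing)
import Algebra.Properties.CommutativeMonoid.Sum as CMSum
import Algebra.Properties.Group as GroupProperties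
import Algebra.Properties.Ring as RingProperties
import Algebra.Properties.Semiring.Mult as SRMult
import Algebra.Properties.Semiring.Sum as SRSum
import Algebra.Solver.Ring as RingSolver
open import Algebra.Solver.Ring.AlmostCommutativeRing using (fromCommutativeRing; _-Raw-AlmostCommutative⟶_; Induced-equivalence)
open import Algebra.Structures using (IsCommutativeRing)
open import Data.Bool using (if_then_else_; true; false)
open import Data.Empty using (⊥-elim)
open import Data.Fin as Fin using (Fin; zero; suc; toℕ)
open import Data.Fin.Permutation using (permutation)
import Data.Fin.Properties as Finₚ
open import Data.Fin.Subset using (Subset; ∣_∣; _∈_)
open import Data.Fin.Subset.Properties using (_∈?_)
open import Data.Integer as ℤ using (ℤ)
import Data.Integer.Properties as ℤₚ
open import Data.List as List using (List; []; _∷_; _++_; allFin; applyUpTo; concatMap; filter; foldr; length; tabulate; upTo)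
import Data.List.Properties as Listₚ
import Data.Maybe as Maybe
open import Data.Nat as ℕ using (ℕ; zero; suc; _<_; z≤n; s≤s; _!)
open import Data.Nat.Combinatorics using (_C_; nCk+nC[k+1]≡[n+1]C[k+1]; nCk≡nC[n∸k]; nCn≡1)
open import Data.Nat.Coprimality using (Coprime; coprime-Bézout)
open import Data.Nat.Divisibility using (_∣_; _∣?_; divides)
open import Data.Nat.DivMod using ([m+kn]%n≡m%n; %-distribˡ-*; m*n/n≡m)
open import Data.Nat.GCD using (module Bézout)
open import Data.Nat.Induction using (<-rec)
import Data.Nat.ListAction as ListAction
open import Data.Nat.Primality using (prime⇒irreducible; prime[2]; ¬prime[1])
import Data.Nat.Properties as ℕₚ
open import Data.Nat.Solver using (module +-*-Solver)
open import Data.Product using (_,_; ∃; proj₁; proj₂)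
open import Data.Rational as ℚ using (ℚ; 0ℚ; 1ℚ)
import Data.Rational.Properties as ℚₚ
import Data.Rational.Solver as ℚSolver
import Data.Rational.Unnormalised as ℚᵘ
import Data.Rational.Unnormalised.Properties as ℚᵘₚ
open import Data.Sum using (inj₁; inj₂)
open import Data.Vec as Vec using (Vec; []; _∷_; here; there)
open import Function using (_∘_; id)
open import Level using (0ℓ)
open import Relation.Binary using (tri<; tri≈; tri>)
open import Relation.Binary.Definitions using (WeaklyDecidable)
open import Relation.Binary.Consequences using (dec⇒weaklyDec)
open import Relation.Binary.PropositionalEquality using (refl; sym; trans; cong; cong₂; subst; isEquivalence; module ≡-Reasoning)
open import Relation.Nullary using (¬_; Dec; yes; no; does)
open import Relation.Nullary.Decidable using (dec-true; dec-false)

open import Data.Nat using (_≤_; _∸_; _^_; _%_)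
open import Data.Nat.DivMod using (_/_)
open import Data.Nat.Primality using (Prime)
open import Data.Product using (_×_)
open import Data.Sum using (_⊎_)
open import Relation.Binary.PropositionalEquality using (_≡_; _≢_)

-- Let H be the set of nonzero squares and χ the quadratic character with χ(0) = 0. The Gaussian periods
-- η(z) = Σ_{h∈H} ψ(hz) = (-1 + χ(z) g + q [z = 0]) / 2, with g² = χ(-1) q, make sense without the additive
-- character ψ, and elementary counting (Σ χ = 0 and Σ_z χ(z) χ(x + cz) = -χ(c) for x, c ≠ 0) gives
-- Σ_{h∈H} η(x + ch) = η(c) η(x). Newton's identities for E_k(y) = (-1)^k Σ_{S⊆H, |S|=k} η(y + ΣS) therefore
-- read k E_k(y) = Σ_{j=1..k} -η(j) E_{k-j}(y). The cycle index A_k / k! with t_j = -η(j) satisfies the same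
-- recurrence (the logarithmic derivative of exp Σ_j t_j x^j / j), so E_k(y) = η(y) A_k / k!.
-- As η⁺ + η⁻ = q [z = 0] - 1 for the two choices ±g, adding the two identities at y = -b counts the subsets
-- with sum b. Finally χ(-1) is found from the parity of |H| via the involutions x ↦ -x and x ↦ 1/x.

-- The values of ψ lie in a cyclotomic field, whereas the theorem is stated in `ℚ[√ D ]`. So the
-- periods enter through their closed form, and the product rule, which ψ would give at once, has to
-- be recovered by counting. Without ψ there is no polynomial Π (1 - ψ(a) x) to expand either. Its
-- substitute is translation: multiplication by ψ(a) becomes the shift of the argument y by a, and
-- the power sum p_j becomes the operator that sums over the shifts by j a with a in H. The product
-- rule says that η is an eigenfunction of all these operators, with eigenvalue η(j) for p_j. This
-- is what turns Newton's identities, an operator identity, into a recurrence with scalar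
-- coefficients. The ring `ℚ[√ D ]` need not be a field: for D = q and s even, q is a perfect square
-- and there are zero divisors. Hence the argument is carried out in an arbitrary commutative
-- ℚ-algebra and divides only by positive integers.

𝟙 : {A : Set} → Dec A → ℕ
𝟙 d = if does d then 1 else 0

𝟙-yes : {A : Set} (d : Dec A) → A → 𝟙 d ≡ 1
𝟙-yes d a rewrite dec-true d a = refl

𝟙-no : {A : Set} (d : Dec A) → ¬ A → 𝟙 d ≡ 0
𝟙-no d ¬a rewrite dec-false d ¬a = refl

𝟙-cong : {A B : Set} (d : Dec A) (e : Dec B) → (A → B) → (B → A) → 𝟙 d ≡ 𝟙 e
𝟙-cong d (yes b) f g = 𝟙-yes d (g b)
𝟙-cong d (no ¬b) f g = 𝟙-no d (¬b ∘ f)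

𝟙≤1 : {A : Set} (d : Dec A) → 𝟙 d ≤ 1
𝟙≤1 (yes _) = ℕₚ.≤-refl
𝟙≤1 (no _)  = z≤n

𝟙≡1⇒ : {A : Set} (d : Dec A) → 𝟙 d ≡ 1 → A
𝟙≡1⇒ (yes a) _ = a

-- Finite sums: reindexing, equality from counting, involutions.

module FiniteSums (M : CommutativeMonoid 0ℓ 0ℓ) where
  open CommutativeMonoid M renaming (sym to ≈-sym; trans to ≈-trans)
  open CMSum M

  sum-reindex : ∀ {n} (f g : Fin n → Fin n) → (∀ x → f (g x) ≡ x) → (∀ x → g (f x) ≡ x) →
                (h : Fin n → Carrier) → sum (h ∘ f) ≈ sum h
  sum-reindex f g fg gf h = ≈-sym (sum-permute h (permutation f g fg gf))

  sum-single : ∀ {n} (a : Fin n) (t : Fin n → Carrier) → (∀ z → z ≢ a → t z ≈ ε) → sum t ≈ t a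
  sum-single {suc n} a t t≈ε = ≈-trans (sum-remove {i = a} t)
    (≈-trans (∙-congˡ (≈-trans (sum-cong-≋ (λ i → t≈ε _ (Finₚ.punchInᵢ≢i a i))) (sum-replicate-zero n)))
             (identityʳ _))

open SRSum ℕₚ.+-*-semiring using () renaming (sum to sumℕ; sum-cong-≗ to sumℕ-cong; ∑-distrib-+ to sumℕ-+; ∑-comm to sumℕ-comm; *-distribˡ-sum to *-distribˡ-sumℕ)
open FiniteSums ℕₚ.+-0-commutativeMonoid using () renaming (sum-reindex to sumℕ-reindex; sum-single to sumℕ-single)

sumℕ-const1 : ∀ n → sumℕ {n} (λ _ → 1) ≡ n
sumℕ-const1 zero    = refl
sumℕ-const1 (suc n) = cong suc (sumℕ-const1 n)

sumℕ-mono : ∀ {n} {f g : Fin n → ℕ} → (∀ i → f i ≤ g i) → sumℕ f ≤ sumℕ g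
sumℕ-mono {zero}  f≤g = z≤n
sumℕ-mono {suc n} f≤g = ℕₚ.+-mono-≤ (f≤g zero) (sumℕ-mono (f≤g ∘ suc))

-- A strict inequality at one index could not be made up at the others. This lets `nonsquare-*` rest
-- on counting, with no generator of the multiplicative group.
sumℕ-≤-equality : ∀ {n} {f g : Fin n → ℕ} → (∀ i → f i ≤ g i) → sumℕ f ≡ sumℕ g → ∀ i → f i ≡ g i
sumℕ-≤-equality {suc n} {f} {g} f≤g Σf≡Σg = pointwise
  where
  head≡ : f zero ≡ g zero
  head≡ = ℕₚ.≤-antisym (f≤g zero)
    (ℕₚ.+-cancelʳ-≤ (sumℕ (f ∘ suc)) (g zero) (f zero)
      (ℕₚ.≤-trans (ℕₚ.+-monoʳ-≤ (g zero) (sumℕ-mono (f≤g ∘ suc))) (ℕₚ.≤-reflexive (sym Σf≡Σg))))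
  tail≡ : sumℕ (f ∘ suc) ≡ sumℕ (g ∘ suc)
  tail≡ = ℕₚ.+-cancelˡ-≡ (f zero) _ _ (trans Σf≡Σg (cong (ℕ._+ sumℕ (g ∘ suc)) (sym head≡)))
  pointwise : ∀ i → f i ≡ g i
  pointwise zero    = head≡
  pointwise (suc i) = sumℕ-≤-equality (f≤g ∘ suc) tail≡ i

-- The points moved upwards by σ are exchanged by σ with those moved downwards.
sumℕ-involution : ∀ {n} (σ : Fin n → Fin n) → (∀ x → σ (σ x) ≡ x) →
  (w : Fin n → ℕ) → (∀ x → w (σ x) ≡ w x) →
  sumℕ w ≡ 2 ℕ.* sumℕ (λ x → 𝟙 (x Finₚ.<? σ x) ℕ.* w x) ℕ.+ sumℕ (λ x → 𝟙 (σ x Finₚ.≟ x) ℕ.* w x)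
sumℕ-involution σ σσ w wσ = begin
  sumℕ w
    ≡⟨ sumℕ-cong split ⟩
  sumℕ (λ x → (up x ℕ.+ down x) ℕ.+ fixed x)
    ≡⟨ sumℕ-+ _ fixed ⟩
  sumℕ (λ x → up x ℕ.+ down x) ℕ.+ sumℕ fixed
    ≡⟨ cong (ℕ._+ sumℕ fixed) (sumℕ-+ up down) ⟩
  (sumℕ up ℕ.+ sumℕ down) ℕ.+ sumℕ fixed
    ≡⟨ cong (λ s → (sumℕ up ℕ.+ s) ℕ.+ sumℕ fixed) (trans (sumℕ-cong down≡up∘σ) (sumℕ-reindex σ σ σσ σσ up)) ⟩
  (sumℕ up ℕ.+ sumℕ up) ℕ.+ sumℕ fixed
    ≡⟨ cong (λ s → (sumℕ up ℕ.+ s) ℕ.+ sumℕ fixed) (sym (ℕₚ.+-identityʳ _)) ⟩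
  2 ℕ.* sumℕ up ℕ.+ sumℕ fixed ∎
  where
  open ≡-Reasoning
  up down fixed : _ → ℕ
  up x    = 𝟙 (x Finₚ.<? σ x) ℕ.* w x
  down x  = 𝟙 (σ x Finₚ.<? x) ℕ.* w x
  fixed x = 𝟙 (σ x Finₚ.≟ x) ℕ.* w x
  down≡up∘σ : ∀ x → down x ≡ up (σ x)
  down≡up∘σ x = cong₂ ℕ._*_
    (𝟙-cong (σ x Finₚ.<? x) (σ x Finₚ.<? σ (σ x)) (subst (σ x Fin.<_) (sym (σσ x))) (subst (σ x Fin.<_) (σσ x)))
    (sym (wσ x))
  split : ∀ x → w x ≡ (up x ℕ.+ down x) ℕ.+ fixed x
  split x with Finₚ.<-cmp x (σ x)
  ... | tri< x<σ x≢σ x≯σ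
    rewrite 𝟙-yes (x Finₚ.<? σ x) x<σ | 𝟙-no (σ x Finₚ.<? x) x≯σ | 𝟙-no (σ x Finₚ.≟ x) (x≢σ ∘ sym)
    = +-*-Solver.solve 1 (λ w → w := ((con 1 :* w) :+ con 0) :+ con 0) refl (w x)
    where open +-*-Solver
  ... | tri≈ x≮σ x≡σ x≯σ
    rewrite 𝟙-no (x Finₚ.<? σ x) x≮σ | 𝟙-no (σ x Finₚ.<? x) x≯σ | 𝟙-yes (σ x Finₚ.≟ x) (sym x≡σ)
    = sym (ℕₚ.+-identityʳ _)
  ... | tri> x≮σ x≢σ x>σ
    rewrite 𝟙-no (x Finₚ.<? σ x) x≮σ | 𝟙-yes (σ x Finₚ.<? x) x>σ | 𝟙-no (σ x Finₚ.≟ x) (x≢σ ∘ sym)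
    = +-*-Solver.solve 1 (λ w → w := (con 1 :* w) :+ con 0) refl (w x)
    where open +-*-Solver

-- Squares and nonsquares in a finite field.

module FieldTheory {q : ℕ} (F : FiniteField q) where

  private
    commutativeRing : CommutativeRing 0ℓ 0ℓ
    commutativeRing = record { isCommutativeRing = FiniteField.isCommutativeRing F }

  open CommutativeRing commutativeRing public using (0#; 1#; _+_; _*_; -_; _-_; +-comm; +-assoc; *-comm; *-assoc; distribˡ; distribʳ; zeroˡ; zeroʳ; +-identityˡ; +-identityʳ; *-identityˡ; *-identityʳ; -‿inverseʳ; -‿inverseˡ; ring)
  open CommutativeRing commutativeRing using (semiring; +-group; +-commutativeMonoid)
  open FiniteField F using (inverse; 0≢1)
  open RingProperties ring using (-‿distribˡ-*; -‿distribʳ-*; -1*x≈-x)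
  open GroupProperties +-group using (x∙y⁻¹≈ε⇒x≈y; ⁻¹-involutive; inverseˡ-unique; ε⁻¹≈ε)
  open SRMult semiring using (×1-homo-*) renaming (_×_ to _·_)
  open ≡-Reasoning

  Sq : Fin q → Set
  Sq = IsNonzeroSquare F

  Sq? : ∀ x → Dec (Sq x)
  Sq? = isNonzeroSquare? F

  sq δ : Fin q → ℕ
  sq x = 𝟙 (Sq? x)
  δ x  = 𝟙 (x Finₚ.≟ 0#)

  δ-0 : δ 0# ≡ 1
  δ-0 = 𝟙-yes (0# Finₚ.≟ 0#) refl

  δ-≢0 : ∀ {x} → x ≢ 0# → δ x ≡ 0
  δ-≢0 = 𝟙-no (_ Finₚ.≟ 0#)

  sq-yes : ∀ {x} → Sq x → sq x ≡ 1
  sq-yes = 𝟙-yes (Sq? _)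

  sq-no : ∀ {x} → ¬ Sq x → sq x ≡ 0
  sq-no = 𝟙-no (Sq? _)

  sq-0 : sq 0# ≡ 0
  sq-0 = sq-no (λ s → proj₁ s refl)

  data QuadraticType (x : Fin q) : Set where
    isZero      : x ≡ 0# → QuadraticType x
    isSquare    : Sq x → QuadraticType x
    isNonsquare : x ≢ 0# → ¬ Sq x → QuadraticType x

  quadraticType : ∀ x → QuadraticType x
  quadraticType x = decide (x Finₚ.≟ 0#) (Sq? x)
    where
    decide : Dec (x ≡ 0#) → Dec (Sq x) → QuadraticType x
    decide (yes x≡0) _       = isZero x≡0
    decide (no _)    (yes s) = isSquare s
    decide (no x≢0)  (no ¬s) = isNonsquare x≢0 ¬s

  -- The convention `inv 0# = 0#` makes inversion an involution of the whole field, so that sums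
  -- over all of `Fin q` can be reindexed by it.
  inv : Fin q → Fin q
  inv x with x Finₚ.≟ 0#
  ... | yes _  = 0#
  ... | no x≢0 = proj₁ (inverse x x≢0)

  inv-0 : inv 0# ≡ 0#
  inv-0 with 0# Finₚ.≟ 0#
  ... | yes _  = refl
  ... | no 0≢0 = ⊥-elim (0≢0 refl)

  *-inv : ∀ {x} → x ≢ 0# → x * inv x ≡ 1#
  *-inv {x} x≢0 with x Finₚ.≟ 0#
  ... | yes x≡0 = ⊥-elim (x≢0 x≡0)
  ... | no x≢0′ = proj₂ (inverse x x≢0′)

  inv-* : ∀ {x} → x ≢ 0# → inv x * x ≡ 1#
  inv-* x≢0 = trans (*-comm _ _) (*-inv x≢0)

  inv-*-cancelˡ : ∀ {x} → x ≢ 0# → ∀ y → inv x * (x * y) ≡ y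
  inv-*-cancelˡ x≢0 y = trans (sym (*-assoc _ _ _)) (trans (cong (_* y) (inv-* x≢0)) (*-identityˡ y))

  *-inv-cancelˡ : ∀ {x} → x ≢ 0# → ∀ y → x * (inv x * y) ≡ y
  *-inv-cancelˡ x≢0 y = trans (sym (*-assoc _ _ _)) (trans (cong (_* y) (*-inv x≢0)) (*-identityˡ y))

  *-cancel-0 : ∀ {x y} → x ≢ 0# → x * y ≡ 0# → y ≡ 0#
  *-cancel-0 {x} {y} x≢0 xy≡0 = trans (sym (inv-*-cancelˡ x≢0 y)) (trans (cong (inv x *_) xy≡0) (zeroʳ _))

  *-≢0 : ∀ {x y} → x ≢ 0# → y ≢ 0# → x * y ≢ 0#
  *-≢0 x≢0 y≢0 xy≡0 = y≢0 (*-cancel-0 x≢0 xy≡0)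

  inv-≢0 : ∀ {x} → x ≢ 0# → inv x ≢ 0#
  inv-≢0 {x} x≢0 i≡0 = 0≢1 (trans (sym (zeroʳ x)) (trans (cong (x *_) (sym i≡0)) (*-inv x≢0)))

  inv-involutive : ∀ x → inv (inv x) ≡ x
  inv-involutive x with x Finₚ.≟ 0#
  ... | yes refl = inv-0
  ... | no x≢0   = begin
    inv i             ≡⟨ *-identityʳ _ ⟨
    inv i * 1#        ≡⟨ cong (inv i *_) i*x≡1 ⟨
    inv i * (i * x)   ≡⟨ inv-*-cancelˡ i≢0 x ⟩
    x                 ∎
    where
    i = proj₁ (inverse x x≢0)
    i*x≡1 : i * x ≡ 1#
    i*x≡1 = trans (*-comm _ _) (proj₂ (inverse x x≢0))
    i≢0 : i ≢ 0#
    i≢0 i≡0 = 0≢1 (trans (sym (zeroˡ x)) (trans (cong (_* x) (sym i≡0)) i*x≡1))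

  -‿≢0 : ∀ {x} → x ≢ 0# → - x ≢ 0#
  -‿≢0 x≢0 -x≡0 = x≢0 (trans (sym (⁻¹-involutive _)) (trans (cong -_ -x≡0) ε⁻¹≈ε))

  square-≢0 : ∀ {x y} → y * y ≡ x → x ≢ 0# → y ≢ 0#
  square-≢0 yy≡x x≢0 refl = x≢0 (trans (sym yy≡x) (zeroʳ 0#))

  Sq-* : ∀ {x y} → Sq x → Sq y → Sq (x * y)
  Sq-* {x} {y} (x≢0 , a , aa≡x) (y≢0 , b , bb≡y) = *-≢0 x≢0 y≢0 , a * b , (begin
    (a * b) * (a * b)   ≡⟨ *-assoc a b (a * b) ⟩
    a * (b * (a * b))   ≡⟨ cong (a *_) (trans (sym (*-assoc b a b)) (trans (cong (_* b) (*-comm b a)) (*-assoc a b b))) ⟩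
    a * (a * (b * b))   ≡⟨ *-assoc a a (b * b) ⟨
    (a * a) * (b * b)   ≡⟨ cong₂ _*_ aa≡x bb≡y ⟩
    x * y               ∎)

  Sq-square : ∀ {x} → x ≢ 0# → Sq (x * x)
  Sq-square x≢0 = *-≢0 x≢0 x≢0 , _ , refl

  -- `inv x` is `x` times the square of `inv x`, so closure under products suffices.
  Sq-inv : ∀ {x} → Sq x → Sq (inv x)
  Sq-inv {x} s@(x≢0 , _) = subst Sq (*-inv-cancelˡ x≢0 (inv x)) (Sq-* s (Sq-square (inv-≢0 x≢0)))

  Sq-*-cancelˡ : ∀ {x y} → Sq x → Sq (x * y) → Sq y
  Sq-*-cancelˡ s@(x≢0 , _) t = subst Sq (inv-*-cancelˡ x≢0 _) (Sq-* (Sq-inv s) t)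

  Sq-1 : Sq 1#
  Sq-1 = (λ 1≡0 → 0≢1 (sym 1≡0)) , 1# , *-identityʳ 1#

  sum-δ : sumℕ δ ≡ 1
  sum-δ = trans (sumℕ-single 0# δ (λ z z≢0 → δ-≢0 z≢0)) δ-0

  square-roots : ∀ {x y} → y * y ≡ x * x → y ≡ x ⊎ y ≡ - x
  square-roots {x} {y} yy≡xx with (y - x) Finₚ.≟ 0#
  ... | yes y-x≡0 = inj₁ (x∙y⁻¹≈ε⇒x≈y y x y-x≡0)
  ... | no y-x≢0  = inj₂ (inverseˡ-unique y x (*-cancel-0 y-x≢0 (begin
    (y - x) * (y + x)                       ≡⟨ distribʳ _ _ _ ⟩
    y * (y + x) + - x * (y + x)             ≡⟨ cong₂ _+_ (distribˡ y y x) (sym (-‿distribˡ-* x (y + x))) ⟩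
    (y * y + y * x) + - (x * (y + x))       ≡⟨ cong₂ (λ a b → a + - b) (cong (_+ y * x) yy≡xx) (trans (distribˡ x y x) (trans (+-comm _ _) (cong (x * x +_) (*-comm x y)))) ⟩
    (x * x + y * x) + - (x * x + y * x)     ≡⟨ -‿inverseʳ _ ⟩
    0#                                      ∎)))

  ι≡· : ∀ n → ι F n ≡ n · 1#
  ι≡· zero    = refl
  ι≡· (suc n) = cong (1# +_) (ι≡· n)

  ι-* : ∀ m n → ι F (m ℕ.* n) ≡ ι F m * ι F n
  ι-* m n = trans (ι≡· (m ℕ.* n)) (trans (×1-homo-* m n) (sym (cong₂ _*_ (ι≡· m) (ι≡· n))))

  -- Translation by 1 permutes the field, so the sum s of all elements satisfies s = q · 1 + s.
  ι-q : ι F q ≡ 0#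
  ι-q = begin
    ι F q               ≡⟨ ι≡· q ⟩
    q · 1#              ≡⟨ sum-replicate q ⟨
    Σ₁                  ≡⟨ +-identityʳ _ ⟨
    Σ₁ + 0#             ≡⟨ cong (Σ₁ +_) (-‿inverseʳ s) ⟨
    Σ₁ + (s - s)        ≡⟨ +-assoc _ _ _ ⟨
    (Σ₁ + s) - s        ≡⟨ cong (_- s) (trans (sym (∑-distrib-+ {q} (λ _ → 1#) (λ x → x))) (sum-reindex (1# +_) (- 1# +_)
                              (λ x → trans (sym (+-assoc _ _ _)) (trans (cong (_+ x) (-‿inverseʳ 1#)) (+-identityˡ x)))
                              (λ x → trans (sym (+-assoc _ _ _)) (trans (cong (_+ x) (-‿inverseˡ 1#)) (+-identityˡ x))) (λ x → x))) ⟩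
    s - s               ≡⟨ -‿inverseʳ s ⟩
    0#                  ∎
    where
    open CMSum +-commutativeMonoid using (sum; sum-replicate; ∑-distrib-+)
    open FiniteSums +-commutativeMonoid
    s Σ₁ : Fin q
    s = sum {q} (λ x → x)
    Σ₁ = sum {q} (λ _ → 1#)

  module OddCharacteristic (2≢0 : 1# + 1# ≢ 0#) where

    -‿≢ : ∀ {x} → x ≢ 0# → - x ≢ x
    -‿≢ {x} x≢0 -x≡x = 2≢0 (*-cancel-0 x≢0 (begin
      x * (1# + 1#)       ≡⟨ distribˡ x 1# 1# ⟩
      x * 1# + x * 1#     ≡⟨ cong₂ _+_ (*-identityʳ x) (trans (*-identityʳ x) (sym -x≡x)) ⟩
      x + - x             ≡⟨ -‿inverseʳ x ⟩
      0#                  ∎))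

    private
      eq : (x y : Fin q) → ℕ
      eq x y = 𝟙 (x Finₚ.≟ y)

      sum-eq : ∀ a → sumℕ (λ z → eq z a) ≡ 1
      sum-eq a = trans (sumℕ-single a (λ z → eq z a) (λ z → 𝟙-no (z Finₚ.≟ a))) (𝟙-yes (a Finₚ.≟ a) refl)

    count-square-roots : ∀ h → sumℕ (λ z → eq (z * z) h) ≡ 2 ℕ.* sq h ℕ.+ δ h
    count-square-roots h with quadraticType h
    ... | isZero refl = trans
      (sumℕ-cong λ z → 𝟙-cong (z * z Finₚ.≟ 0#) (z Finₚ.≟ 0#)
        (λ zz≡0 → zero-square z zz≡0) (λ { refl → zeroʳ 0# }))
      (trans (sum-eq 0#) (sym (cong₂ (λ s d → 2 ℕ.* s ℕ.+ d) sq-0 δ-0)))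
      where
      zero-square : ∀ z → z * z ≡ 0# → z ≡ 0#
      zero-square z zz≡0 with z Finₚ.≟ 0#
      ... | yes z≡0 = z≡0
      ... | no z≢0  = *-cancel-0 z≢0 zz≡0
    ... | isNonsquare h≢0 ¬s = trans
      (sumℕ-cong λ z → 𝟙-no (z * z Finₚ.≟ h) (λ zz≡h → ¬s (h≢0 , z , zz≡h)))
      -- Pulling the factor 0 out of a sum of ones shows that a sum of zeros vanishes.
      (trans (sym (*-distribˡ-sumℕ {q} 0 (λ _ → 1))) (sym (cong₂ (λ s d → 2 ℕ.* s ℕ.+ d) (sq-no ¬s) (δ-≢0 h≢0))))
    ... | isSquare s@(h≢0 , y , yy≡h) = trans (sumℕ-cong two-roots)
      (trans (sumℕ-+ (λ z → eq z y) (λ z → eq z (- y)))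
      (trans (cong₂ ℕ._+_ (sum-eq y) (sum-eq (- y))) (sym (cong₂ (λ s d → 2 ℕ.* s ℕ.+ d) (sq-yes s) (δ-≢0 h≢0)))))
      where
      y≢0 = square-≢0 yy≡h h≢0
      neg-root : - y * - y ≡ h
      neg-root = trans (sym (-‿distribˡ-* y (- y))) (trans (cong -_ (sym (-‿distribʳ-* y y)))
                   (trans (⁻¹-involutive _) yy≡h))
      -- In odd characteristic `y` and `- y` differ, so at most one indicator on the right is 1.
      two-roots : ∀ z → eq (z * z) h ≡ eq z y ℕ.+ eq z (- y)
      two-roots z with z Finₚ.≟ y
      ... | yes refl = trans (𝟙-yes (z * z Finₚ.≟ h) yy≡h)
                         (sym (cong (1 ℕ.+_) (𝟙-no (z Finₚ.≟ - z) (λ z≡-z → -‿≢ y≢0 (sym z≡-z)))))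
      ... | no z≢y = 𝟙-cong (z * z Finₚ.≟ h) (z Finₚ.≟ - y)
                       (λ zz≡h → other (square-roots (trans zz≡h (sym yy≡h)))) (λ { refl → neg-root })
        where
        other : z ≡ y ⊎ z ≡ - y → z ≡ - y
        other (inj₁ z≡y)  = ⊥-elim (z≢y z≡y)
        other (inj₂ z≡-y) = z≡-y

    -- Double counting of the pairs (h, z) with `z * z ≡ h`: every z has one square, and every h has
    -- the number of roots found above.
    count-squares : 2 ℕ.* sumℕ sq ℕ.+ 1 ≡ q
    count-squares = begin
      2 ℕ.* sumℕ sq ℕ.+ 1                           ≡⟨ cong₂ ℕ._+_ (*-distribˡ-sumℕ 2 sq) (sym sum-δ) ⟩
      sumℕ (λ h → 2 ℕ.* sq h) ℕ.+ sumℕ δ            ≡⟨ sumℕ-+ (λ h → 2 ℕ.* sq h) δ ⟨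
      sumℕ (λ h → 2 ℕ.* sq h ℕ.+ δ h)               ≡⟨ sumℕ-cong (λ h → sym (count-square-roots h)) ⟩
      sumℕ (λ h → sumℕ (λ z → eq (z * z) h))        ≡⟨ sumℕ-comm (λ h z → eq (z * z) h) ⟩
      sumℕ (λ z → sumℕ (λ h → eq (z * z) h))        ≡⟨ sumℕ-cong (λ z → trans (sumℕ-cong λ h → 𝟙-cong (z * z Finₚ.≟ h) (h Finₚ.≟ z * z) sym sym) (sum-eq (z * z))) ⟩
      sumℕ {q} (λ z → 1)                            ≡⟨ sumℕ-const1 q ⟩
      q                                             ∎

    -- For a nonsquare a, each x is at most one of: a square, a⁻¹ times a square, zero;
    -- by counting, it is exactly one of them.
    nonsquare-* : ∀ {a b} → a ≢ 0# → ¬ Sq a → b ≢ 0# → ¬ Sq b → Sq (a * b)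
    nonsquare-* {a} {b} a≢0 ¬a b≢0 ¬b = 𝟙≡1⇒ (Sq? (a * b)) (trans
      (sym (trans (cong₂ (λ m n → m ℕ.+ (sq (a * b) ℕ.+ n)) (sq-no ¬b) (δ-≢0 b≢0)) (ℕₚ.+-identityʳ _)))
      (sumℕ-≤-equality at-most-one total b))
      where
      f : Fin q → ℕ
      f x = sq x ℕ.+ (sq (a * x) ℕ.+ δ x)
      at-most-one : ∀ x → f x ≤ 1
      at-most-one x with quadraticType x
      ... | isZero refl rewrite sq-0 | zeroʳ a | sq-0 | δ-0 = ℕₚ.≤-refl
      ... | isSquare s rewrite sq-yes s | sq-no (λ t → ¬a (Sq-*-cancelˡ s (subst Sq (*-comm a x) t))) | δ-≢0 (proj₁ s) = ℕₚ.≤-refl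
      ... | isNonsquare x≢0 ¬s rewrite sq-no ¬s | δ-≢0 x≢0 | ℕₚ.+-identityʳ (sq (a * x)) = 𝟙≤1 (Sq? (a * x))
      total : sumℕ f ≡ sumℕ {q} (λ _ → 1)
      total = begin
        sumℕ f
          ≡⟨ trans (sumℕ-+ sq _) (cong (sumℕ sq ℕ.+_) (sumℕ-+ (λ x → sq (a * x)) δ)) ⟩
        sumℕ sq ℕ.+ (sumℕ (λ x → sq (a * x)) ℕ.+ sumℕ δ)
          ≡⟨ cong₂ (λ m n → sumℕ sq ℕ.+ (m ℕ.+ n)) (sumℕ-reindex (a *_) (inv a *_) (*-inv-cancelˡ a≢0) (inv-*-cancelˡ a≢0) sq) sum-δ ⟩
        sumℕ sq ℕ.+ (sumℕ sq ℕ.+ 1)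
          ≡⟨ +-*-Solver.solve 1 (λ s → s :+ (s :+ con 1) := con 2 :* s :+ con 1) refl (sumℕ sq) ⟩
        2 ℕ.* sumℕ sq ℕ.+ 1
          ≡⟨ trans count-squares (sym (sumℕ-const1 q)) ⟩
        sumℕ {q} (λ _ → 1) ∎
        where open +-*-Solver

    Sq-neg : Sq (- 1#) → ∀ {x} → Sq x → Sq (- x)
    Sq-neg s {x} t = subst Sq (-1*x≈-x x) (Sq-* s t)

    -- If -1 is a square then negation is a fixed point free involution of the squares.
    Sq[-1]⇒even : Sq (- 1#) → ∃ λ m → sumℕ sq ≡ 2 ℕ.* m
    Sq[-1]⇒even s = ups , trans (sumℕ-involution -_ ⁻¹-involutive sq neg-sq) (trans
      (cong (2 ℕ.* ups ℕ.+_) (trans (sumℕ-cong no-fixed-point) (sym (*-distribˡ-sumℕ {q} 0 (λ _ → 1))))) (ℕₚ.+-identityʳ _))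
      where
      ups = sumℕ (λ x → 𝟙 (x Finₚ.<? - x) ℕ.* sq x)
      neg-sq : ∀ x → sq (- x) ≡ sq x
      neg-sq x = 𝟙-cong (Sq? (- x)) (Sq? x) (subst Sq (⁻¹-involutive x) ∘ Sq-neg s) (Sq-neg s)
      no-fixed-point : ∀ x → 𝟙 (- x Finₚ.≟ x) ℕ.* sq x ≡ 0
      no-fixed-point x with quadraticType x
      ... | isZero refl        rewrite sq-0 = ℕₚ.*-zeroʳ (𝟙 (- 0# Finₚ.≟ 0#))
      ... | isSquare t         rewrite 𝟙-no (- x Finₚ.≟ x) (-‿≢ (proj₁ t)) = refl
      ... | isNonsquare _ ¬t   rewrite sq-no ¬t = ℕₚ.*-zeroʳ (𝟙 (- x Finₚ.≟ x))

    -- If -1 is not a square then inversion is an involution of the squares fixing only 1.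
    ¬Sq[-1]⇒odd : ¬ Sq (- 1#) → ∃ λ m → sumℕ sq ≡ 2 ℕ.* m ℕ.+ 1
    ¬Sq[-1]⇒odd ¬s = ups , trans (sumℕ-involution inv inv-involutive sq inv-sq)
      (cong (2 ℕ.* ups ℕ.+_) (trans (sumℕ-cong fixed-point) (sum-eq 1#)))
      where
      ups = sumℕ (λ x → 𝟙 (x Finₚ.<? inv x) ℕ.* sq x)
      inv-sq : ∀ x → sq (inv x) ≡ sq x
      inv-sq x = 𝟙-cong (Sq? (inv x)) (Sq? x) (subst Sq (inv-involutive x) ∘ Sq-inv) Sq-inv
      fixed-point : ∀ x → 𝟙 (inv x Finₚ.≟ x) ℕ.* sq x ≡ eq x 1#
      fixed-point x with quadraticType x
      ... | isZero refl        rewrite sq-0 = trans (ℕₚ.*-zeroʳ (𝟙 (inv 0# Finₚ.≟ 0#))) (sym (𝟙-no (0# Finₚ.≟ 1#) 0≢1))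
      ... | isNonsquare _ ¬t   rewrite sq-no ¬t = trans (ℕₚ.*-zeroʳ (𝟙 (inv x Finₚ.≟ x)))
                                 (sym (𝟙-no (x Finₚ.≟ 1#) (λ { refl → ¬t Sq-1 })))
      ... | isSquare t         rewrite sq-yes t = trans (ℕₚ.*-identityʳ _) (𝟙-cong (inv x Finₚ.≟ x) (x Finₚ.≟ 1#)
                                 (λ ix≡x → root (square-roots (trans (cong (x *_) (sym ix≡x)) (trans (*-inv (proj₁ t)) (sym (*-identityʳ 1#))))))
                                 (λ { refl → trans (sym (*-identityˡ _)) (*-inv (proj₁ t)) }))
        where
        root : x ≡ 1# ⊎ x ≡ - 1# → x ≡ 1#
        root (inj₁ x≡1)  = x≡1
        root (inj₂ refl) = ⊥-elim (¬s t)

    -- If -1 were not a square, then |H| = 2m + 1 and q = 2 |H| + 1 = 4m + 3. The companion below is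
    -- the same computation with |H| = 2m.
    ≡1mod4⇒Sq[-1] : q ℕ.% 4 ≡ 1 → Sq (- 1#)
    ≡1mod4⇒Sq[-1] q%4≡1 with Sq? (- 1#)
    ... | yes s = s
    ... | no ¬s = ⊥-elim (1≢3 (trans (sym q%4≡1) (trans (cong (ℕ._% 4) q≡3+m*4) ([m+kn]%n≡m%n 3 m 4))))
      where
      m = proj₁ (¬Sq[-1]⇒odd ¬s)
      1≢3 : 1 ≢ 3
      1≢3 ()
      q≡3+m*4 : q ≡ 3 ℕ.+ m ℕ.* 4
      q≡3+m*4 = trans (sym count-squares) (trans (cong (λ n → 2 ℕ.* n ℕ.+ 1) (proj₂ (¬Sq[-1]⇒odd ¬s)))
        (solve 1 (λ m → con 2 :* (con 2 :* m :+ con 1) :+ con 1 := con 3 :+ m :* con 4) refl m))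
        where open +-*-Solver

    ≡3mod4⇒¬Sq[-1] : q ℕ.% 4 ≡ 3 → ¬ Sq (- 1#)
    ≡3mod4⇒¬Sq[-1] q%4≡3 s = 1≢3 (trans (sym ([m+kn]%n≡m%n 1 m 4)) (trans (sym (cong (ℕ._% 4) q≡1+m*4)) q%4≡3))
      where
      m = proj₁ (Sq[-1]⇒even s)
      1≢3 : 1 ≢ 3
      1≢3 ()
      q≡1+m*4 : q ≡ 1 ℕ.+ m ℕ.* 4
      q≡1+m*4 = trans (sym count-squares) (trans (cong (λ n → 2 ℕ.* n ℕ.+ 1) (proj₂ (Sq[-1]⇒even s)))
        (solve 1 (λ m → con 2 :* (con 2 :* m) :+ con 1 := con 1 :+ m :* con 4) refl m))
        where open +-*-Solver

  -- Images of integers in the field: zero exactly at the multiples of p.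

  module Characteristic {p s : ℕ} (prime : Prime p) (q≡p^s : q ≡ p ℕ.^ s) where

    -- By `ι-q` the power p^s maps to zero. While `ι F p` is nonzero, one factor after another can
    -- be cancelled, until p^0 = 1 would be zero.
    ι-p : ι F p ≡ 0#
    ι-p = descend s (trans (sym (cong (ι F) q≡p^s)) ι-q)
      where
      descend : ∀ s → ι F (p ℕ.^ s) ≡ 0# → ι F p ≡ 0#
      descend zero    1+0≡0 = ⊥-elim (0≢1 (trans (sym 1+0≡0) (+-identityʳ 1#)))
      descend (suc s) e with ι F p Finₚ.≟ 0#
      ... | yes ιp≡0 = ιp≡0
      ... | no ιp≢0  = descend s (*-cancel-0 ιp≢0 (trans (sym (ι-* p (p ℕ.^ s))) e))

    ι-multiple : ∀ c → ι F (c ℕ.* p) ≡ 0#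
    ι-multiple c = trans (ι-* c p) (trans (cong (ι F c *_) ι-p) (zeroʳ _))

    ∣⇒ι≡0 : ∀ {j} → p ∣ j → ι F j ≡ 0#
    ∣⇒ι≡0 (divides c refl) = ι-multiple c

    -- A Bézout relation between p and j expresses 1 through multiples of both. If both mapped to
    -- zero, then so would 1.
    ∤⇒ι≢0 : ∀ {j} → ¬ p ∣ j → ι F j ≢ 0#
    ∤⇒ι≢0 {j} p∤j ιj≡0 = bezout (coprime-Bézout coprime)
      where
      coprime : Coprime p j
      coprime (d∣p , d∣j) with prime⇒irreducible prime d∣p
      ... | inj₁ d≡1 = d≡1
      ... | inj₂ refl = ⊥-elim (p∤j d∣j)
      ι-multiple-j : ∀ c → ι F (c ℕ.* j) ≡ 0#
      ι-multiple-j c = trans (ι-* c j) (trans (cong (ι F c *_) ιj≡0) (zeroʳ _))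
      one≡ : ∀ {m n} → ι F n ≡ 0# → ι F m ≡ 0# → 1 ℕ.+ m ≡ n → 0# ≡ 1#
      one≡ {m} ιn≡0 ιm≡0 refl = trans (sym ιn≡0) (trans (cong (1# +_) ιm≡0) (+-identityʳ 1#))
      bezout : ¬ Bézout.Identity 1 p j
      bezout (Bézout.+- x y e) = 0≢1 (one≡ (ι-multiple x) (ι-multiple-j y) e)
      bezout (Bézout.-+ x y e) = 0≢1 (one≡ (ι-multiple-j y) (ι-multiple x) e)

    1+1≢0 : p ℕ.% 2 ≡ 1 → 1# + 1# ≢ 0#
    1+1≢0 p%2≡1 1+1≡0 = ∤⇒ι≢0 p∤2 (trans (cong (1# +_) (+-identityʳ 1#)) 1+1≡0)
      where
      p∤2 : ¬ p ∣ 2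
      p∤2 p∣2 with prime⇒irreducible prime[2] p∣2
      ... | inj₁ refl = ¬prime[1] prime
      ... | inj₂ p≡2  = ℕₚ.0≢1+n (trans (sym (cong (ℕ._% 2) p≡2)) p%2≡1)

-- Residues of p^s modulo 4.

^-%4-1 : ∀ p s → p ℕ.% 4 ≡ 1 → (p ℕ.^ s) ℕ.% 4 ≡ 1
^-%4-1 p zero    _     = refl
^-%4-1 p (suc s) p%4≡1 = trans (%-distribˡ-* p (p ℕ.^ s) 4)
  (cong₂ (λ a b → (a ℕ.* b) ℕ.% 4) p%4≡1 (^-%4-1 p s p%4≡1))

-- The residue has period two in s because 3 * 3 is 1 modulo 4. The right-hand side of `step`
-- evaluates to r for r = 1 and r = 3.
^-%4-3 : ∀ p s → p ℕ.% 4 ≡ 3 → (s ℕ.% 2 ≡ 0 → (p ℕ.^ s) ℕ.% 4 ≡ 1) × (s ℕ.% 2 ≡ 1 → (p ℕ.^ s) ℕ.% 4 ≡ 3)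
^-%4-3 p zero          _     = (λ _ → refl) , λ ()
^-%4-3 p (suc zero)    p%4≡3 = (λ ()) , λ _ → trans (cong (ℕ._% 4) (ℕₚ.*-identityʳ p)) p%4≡3
^-%4-3 p (suc (suc s)) p%4≡3 with ^-%4-3 p s p%4≡3
... | even , odd = (λ e → step (even e)) , (λ o → step (odd o))
  where
  step : ∀ {r} → (p ℕ.^ s) ℕ.% 4 ≡ r → (p ℕ.^ suc (suc s)) ℕ.% 4 ≡ (3 ℕ.* (3 ℕ.* r ℕ.% 4)) ℕ.% 4
  step refl = trans (%-distribˡ-* p (p ℕ.^ suc s) 4) (cong₂ (λ a b → (a ℕ.* b) ℕ.% 4) p%4≡3
    (trans (%-distribˡ-* p (p ℕ.^ s) 4) (cong (λ a → (a ℕ.* ((p ℕ.^ s) ℕ.% 4)) ℕ.% 4) p%4≡3)))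

-- Arithmetic of integers and reciprocals inside the rationals.

fromℚᵘ-* : ∀ x y → ℚ.fromℚᵘ (x ℚᵘ.* y) ≡ ℚ.fromℚᵘ x ℚ.* ℚ.fromℚᵘ y
fromℚᵘ-* x y = ℚₚ.toℚᵘ-injective (ℚᵘₚ.≃-trans (ℚₚ.toℚᵘ-fromℚᵘ (x ℚᵘ.* y)) (ℚᵘₚ.≃-sym
  (ℚᵘₚ.≃-trans (ℚₚ.toℚᵘ-homo-* (ℚ.fromℚᵘ x) (ℚ.fromℚᵘ y)) (ℚᵘₚ.*-cong (ℚₚ.toℚᵘ-fromℚᵘ x) (ℚₚ.toℚᵘ-fromℚᵘ y)))))

fromℚᵘ-+ : ∀ x y → ℚ.fromℚᵘ (x ℚᵘ.+ y) ≡ ℚ.fromℚᵘ x ℚ.+ ℚ.fromℚᵘ y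
fromℚᵘ-+ x y = ℚₚ.toℚᵘ-injective (ℚᵘₚ.≃-trans (ℚₚ.toℚᵘ-fromℚᵘ (x ℚᵘ.+ y)) (ℚᵘₚ.≃-sym
  (ℚᵘₚ.≃-trans (ℚₚ.toℚᵘ-homo-+ (ℚ.fromℚᵘ x) (ℚ.fromℚᵘ y)) (ℚᵘₚ.+-cong (ℚₚ.toℚᵘ-fromℚᵘ x) (ℚₚ.toℚᵘ-fromℚᵘ y)))))

-- Both `i ℚ./ 1` and `recip (suc n)` are values of `ℚ.fromℚᵘ` by computation, so the identities
-- below can be checked on unnormalised fractions, away from the gcd hidden in `ℚ`.
fromℤ : ℤ → ℚ
fromℤ i = i ℚ./ 1

fromℤ-+ : ∀ i j → fromℤ (i ℤ.+ j) ≡ fromℤ i ℚ.+ fromℤ j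
fromℤ-+ i j = trans (ℚₚ.fromℚᵘ-cong {ℚᵘ.mkℚᵘ (i ℤ.+ j) 0} {ℚᵘ.mkℚᵘ i 0 ℚᵘ.+ ℚᵘ.mkℚᵘ j 0}
    (ℚᵘ.*≡* (cong (ℤ._* (ℤ.+ 1)) (cong₂ ℤ._+_ (sym (ℤₚ.*-identityʳ i)) (sym (ℤₚ.*-identityʳ j))))))
  (fromℚᵘ-+ (ℚᵘ.mkℚᵘ i 0) (ℚᵘ.mkℚᵘ j 0))

fromℤ-* : ∀ i j → fromℤ (i ℤ.* j) ≡ fromℤ i ℚ.* fromℤ j
fromℤ-* i j = fromℚᵘ-* (ℚᵘ.mkℚᵘ i 0) (ℚᵘ.mkℚᵘ j 0)

/2≡*half : ∀ i → i ℚ./ 2 ≡ fromℤ i ℚ.* half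
/2≡*half i = trans (cong (ℚ._/ 2) (sym (ℤₚ.*-identityʳ i))) (fromℚᵘ-* (ℚᵘ.mkℚᵘ i 0) (ℚᵘ.mkℚᵘ (ℤ.+ 1) 1))

-- The default `recip 0 = 0` makes `recip` multiplicative on all of ℕ, so products of powers and
-- factorials split with no side conditions.
recip-* : ∀ m n → recip (m ℕ.* n) ≡ recip m ℚ.* recip n
recip-* zero    n       = sym (ℚₚ.*-zeroˡ (recip n))
recip-* (suc m) zero    = trans (cong recip (ℕₚ.*-zeroʳ m)) (sym (ℚₚ.*-zeroʳ (recip (suc m))))
recip-* (suc m) (suc n) = fromℚᵘ-* (ℚᵘ.mkℚᵘ (ℤ.+ 1) m) (ℚᵘ.mkℚᵘ (ℤ.+ 1) n)

fromℤ-*-recip : ∀ n → fromℤ (ℤ.+ suc n) ℚ.* recip (suc n) ≡ 1ℚ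
fromℤ-*-recip n = trans (sym (fromℚᵘ-* (ℚᵘ.mkℚᵘ (ℤ.+ suc n) 0) (ℚᵘ.mkℚᵘ (ℤ.+ 1) n)))
  (ℚₚ.fromℚᵘ-cong {ℚᵘ.mkℚᵘ (ℤ.+ suc n) 0 ℚᵘ.* ℚᵘ.mkℚᵘ (ℤ.+ 1) n} {ℚᵘ.mkℚᵘ (ℤ.+ 1) 0}
    (ℚᵘ.*≡* (trans (ℤₚ.*-identityʳ _) (trans (ℤₚ.*-identityʳ _)
      (sym (trans (ℤₚ.*-identityˡ _) (cong (λ m → ℤ.+ suc m) (ℕₚ.+-identityʳ n))))))))

-- Commutative ℚ-algebras, their ring solver and their sums.

record ℚ-Algebra : Set₁ where
  infixl 6 _+_
  infixl 7 _*_
  infix  8 -_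
  field
    Carrier : Set
    _+_ _*_ : Carrier → Carrier → Carrier
    -_      : Carrier → Carrier
    emb     : ℚ → Carrier
    isCommutativeRing : IsCommutativeRing _≡_ _+_ _*_ -_ (emb 0ℚ) (emb 1ℚ)
    emb-+   : ∀ x y → emb (x ℚ.+ y) ≡ emb x + emb y
    emb-*   : ∀ x y → emb (x ℚ.* y) ≡ emb x * emb y
    emb-neg : ∀ x → emb (ℚ.- x) ≡ - emb x

  commutativeRing : CommutativeRing 0ℓ 0ℓ
  commutativeRing = record { isCommutativeRing = isCommutativeRing }

  open CommutativeRing commutativeRing public
    using (0#; 1#; _-_; +-assoc; +-comm; +-identityˡ; +-identityʳ; *-assoc; *-comm; *-identityˡ; *-identityʳ; zeroˡ; zeroʳ; distribˡ; distribʳ; -‿inverseʳ; semiring; +-commutativeMonoid)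

  -- With ℚ as its coefficient ring the solver computes with constants such as `con half` and so
  -- proves identities that contain halves.
  morphism : ℚₚ.+-*-rawRing -Raw-AlmostCommutative⟶ fromCommutativeRing commutativeRing
  morphism = record { ⟦_⟧ = emb ; +-homo = emb-+ ; *-homo = emb-* ; -‿homo = emb-neg ; 0-homo = refl ; 1-homo = refl }

  emb-≟ : WeaklyDecidable (Induced-equivalence morphism)
  emb-≟ x y = Maybe.map (cong emb) (dec⇒weaklyDec ℚ._≟_ x y)

  module Solver = RingSolver ℚₚ.+-*-rawRing (fromCommutativeRing commutativeRing) morphism emb-≟

  open SRSum semiring public using (sum; sum-cong-≗; ∑-distrib-+; *-distribˡ-sum; sum-replicate-zero; sum-init-last)
  open FiniteSums +-commutativeMonoid public

  ν : ℕ → Carrier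
  ν n = emb (fromℤ (ℤ.+ n))

  ν-+ : ∀ m n → ν (m ℕ.+ n) ≡ ν m + ν n
  ν-+ m n = trans (cong emb (fromℤ-+ (ℤ.+ m) (ℤ.+ n))) (emb-+ _ _)

  ν-* : ∀ m n → ν (m ℕ.* n) ≡ ν m * ν n
  ν-* m n = trans (cong (emb ∘ fromℤ) (ℤₚ.pos-* m n)) (trans (cong emb (fromℤ-* (ℤ.+ m) (ℤ.+ n))) (emb-* _ _))

  ν-*-recip : ∀ n → ν (suc n) * emb (recip (suc n)) ≡ 1#
  ν-*-recip n = trans (sym (emb-* _ _)) (cong emb (fromℤ-*-recip n))

  emb-[1-n]/2 : ∀ n → emb ((ℤ.+ 1 ℤ.- ℤ.+ n) ℚ./ 2) ≡ emb half * (1# - ν n)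
  emb-[1-n]/2 n = trans (cong emb (/2≡*half i)) (trans (emb-* _ _) (trans (*-comm _ _) (cong (emb half *_)
    (trans (solve 2 (λ x y → x := (x :+ y) :- y) refl (emb (fromℤ i)) (ν n))
           (cong (_- ν n) (trans (sym (emb-+ _ _)) (cong emb (trans (sym (fromℤ-+ i (ℤ.+ n))) (cong fromℤ 1-n+n)))))))))
    where
    open Solver
    i = ℤ.+ 1 ℤ.- ℤ.+ n
    1-n+n : i ℤ.+ ℤ.+ n ≡ ℤ.+ 1
    1-n+n = trans (ℤₚ.+-assoc (ℤ.+ 1) (ℤ.- ℤ.+ n) (ℤ.+ n)) (trans (cong (λ z → ℤ.1ℤ ℤ.+ z) (ℤₚ.+-inverseˡ (ℤ.+ n))) (ℤₚ.+-identityʳ (ℤ.+ 1)))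

  -- Positive integers are units even if the algebra has zero divisors; this is what allows Newton's
  -- identities to determine the signed subset sums.
  ν-cancel : ∀ n {x y} → ν (suc n) * x ≡ ν (suc n) * y → x ≡ y
  ν-cancel n {x} {y} e = trans (sym (undo x)) (trans (cong (emb (recip (suc n)) *_) e) (undo y))
    where
    undo : ∀ z → emb (recip (suc n)) * (ν (suc n) * z) ≡ z
    undo z = trans (sym (*-assoc _ _ _)) (trans (cong (_* z) (trans (*-comm _ _) (ν-*-recip n))) (*-identityˡ z))

  sum-ν : ∀ {n} (f : Fin n → ℕ) → sum (ν ∘ f) ≡ ν (sumℕ f)
  sum-ν {zero}  f = refl
  sum-ν {suc n} f = trans (cong (ν (f zero) +_) (sum-ν (f ∘ suc))) (sym (ν-+ (f zero) (sumℕ (f ∘ suc))))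

  -- A fold over a mapped list, as in the definition of `A`, so that the two agree by computation.
  Σᴸ : {X : Set} → (X → Carrier) → List X → Carrier
  Σᴸ f xs = foldr _+_ 0# (List.map f xs)

  Σᴸ-cong : {X : Set} {f g : X → Carrier} → (∀ x → f x ≡ g x) → ∀ xs → Σᴸ f xs ≡ Σᴸ g xs
  Σᴸ-cong f≗g xs = cong (foldr _+_ 0#) (Listₚ.map-cong f≗g xs)

  Σᴸ-++ : {X : Set} (f : X → Carrier) → ∀ xs ys → Σᴸ f (xs ++ ys) ≡ Σᴸ f xs + Σᴸ f ys
  Σᴸ-++ f []       ys = sym (+-identityˡ _)
  Σᴸ-++ f (x ∷ xs) ys = trans (cong (f x +_) (Σᴸ-++ f xs ys)) (sym (+-assoc _ _ _))

  Σᴸ-concatMap : {X Y : Set} (f : Y → Carrier) (g : X → List Y) → ∀ xs → Σᴸ f (concatMap g xs) ≡ Σᴸ (Σᴸ f ∘ g) xs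
  Σᴸ-concatMap f g []       = refl
  Σᴸ-concatMap f g (x ∷ xs) = trans (Σᴸ-++ f (g x) (concatMap g xs)) (cong (Σᴸ f (g x) +_) (Σᴸ-concatMap f g xs))

  Σᴸ-map : {X Y : Set} (f : Y → Carrier) (g : X → Y) → ∀ xs → Σᴸ f (List.map g xs) ≡ Σᴸ (f ∘ g) xs
  Σᴸ-map f g xs = cong (foldr _+_ 0#) (sym (Listₚ.map-∘ xs))

  Σᴸ-* : {X : Set} (a : Carrier) (f : X → Carrier) → ∀ xs → Σᴸ (λ x → a * f x) xs ≡ a * Σᴸ f xs
  Σᴸ-* a f []       = sym (zeroʳ a)
  Σᴸ-* a f (x ∷ xs) = trans (cong (a * f x +_) (Σᴸ-* a f xs)) (sym (distribˡ a _ _))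

  Σᴸ-+ : {X : Set} (f g : X → Carrier) → ∀ xs → Σᴸ (λ x → f x + g x) xs ≡ Σᴸ f xs + Σᴸ g xs
  Σᴸ-+ f g []       = sym (+-identityˡ _)
  Σᴸ-+ f g (x ∷ xs) = trans (cong ((f x + g x) +_) (Σᴸ-+ f g xs))
    (solve 4 (λ a b c d → (a :+ b) :+ (c :+ d) := (a :+ c) :+ (b :+ d)) refl (f x) (g x) (Σᴸ f xs) (Σᴸ g xs))
    where open Solver

  Σᴸ-filter : {X : Set} {P : X → Set} (P? : ∀ x → Dec (P x)) (f : X → Carrier) → ∀ xs →
              Σᴸ f (filter P? xs) ≡ Σᴸ (λ x → if does (P? x) then f x else 0#) xs
  Σᴸ-filter P? f []       = refl
  Σᴸ-filter P? f (x ∷ xs) with does (P? x)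
  ... | true  = cong (f x +_) (Σᴸ-filter P? f xs)
  ... | false = trans (Σᴸ-filter P? f xs) (sym (+-identityˡ _))

  Σᴸ-applyUpTo : (f : ℕ → Carrier) (g : ℕ → ℕ) → ∀ n → Σᴸ f (applyUpTo g n) ≡ sum {n} (λ i → f (g (toℕ i)))
  Σᴸ-applyUpTo f g zero    = refl
  Σᴸ-applyUpTo f g (suc n) = cong (f (g 0) +_) (Σᴸ-applyUpTo f (g ∘ suc) n)

-- The exponential formula: with a fixed total k, Q o n d is the coefficient of x^(k-d) in
-- exp (Σ_j t_j x^j / j), where j ranges over o+1, …, o+n.
module CycleIndex (𝓐 : ℚ-Algebra) (k : ℕ)
  (t : ℕ → ℚ-Algebra.Carrier 𝓐) (tpow : ℕ → ℕ → ℚ-Algebra.Carrier 𝓐)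
  (tpow-zero : ∀ j → tpow j 0 ≡ ℚ-Algebra.1# 𝓐)
  (tpow-suc : ∀ j c → tpow j (suc c) ≡ ℚ-Algebra._*_ 𝓐 (t j) (tpow j c)) where

  open ℚ-Algebra 𝓐
  open ≡-Reasoning

  -- The coefficient of x^(j c) in exp (t_j x^j / j).
  α : ℕ → ℕ → Carrier
  α j c = emb (recip (j ^ c ℕ.* c !)) * tpow j c

  α-zero : ∀ j → α j 0 ≡ 1#
  α-zero j = trans (*-identityˡ _) (tpow-zero j)

  -- For j = o + 1 this is the equation x d/dx exp (t_j x^j / j) = t_j x^j exp (t_j x^j / j), read
  -- off coefficientwise.
  α-suc : ∀ o c → ν (suc o ℕ.* suc c) * α (suc o) (suc c) ≡ t (suc o) * α (suc o) c
  α-suc o c = begin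
    ν (j ℕ.* suc c) * (emb (recip ((j ℕ.* j ^ c) ℕ.* (suc c ℕ.* c !))) * tpow j (suc c))
      ≡⟨ cong₂ _*_ (ν-* j (suc c)) (cong₂ _*_ split (tpow-suc j c)) ⟩
    (ν j * ν (suc c)) * (((emb (recip j) * emb (recip (suc c))) * r) * (t j * tpow j c))
      ≡⟨ solve 7 (λ a b a′ b′ r t p → (a :* b) :* (((a′ :* b′) :* r) :* (t :* p)) := (a :* a′) :* ((b :* b′) :* (t :* (r :* p)))) refl
           (ν j) (ν (suc c)) (emb (recip j)) (emb (recip (suc c))) r (t j) (tpow j c) ⟩
    (ν j * emb (recip j)) * ((ν (suc c) * emb (recip (suc c))) * (t j * (r * tpow j c)))
      ≡⟨ cong₂ (λ x y → x * (y * (t j * (r * tpow j c)))) (ν-*-recip o) (ν-*-recip c) ⟩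
    1# * (1# * (t j * (r * tpow j c)))
      ≡⟨ trans (*-identityˡ _) (*-identityˡ _) ⟩
    t j * (r * tpow j c) ∎
    where
    open Solver
    j = suc o
    r = emb (recip (j ^ c ℕ.* c !))
    split : emb (recip ((j ℕ.* j ^ c) ℕ.* (suc c ℕ.* c !))) ≡ (emb (recip j) * emb (recip (suc c))) * r
    split = begin
      emb (recip ((j ℕ.* j ^ c) ℕ.* (suc c ℕ.* c !)))
        ≡⟨ cong (emb ∘ recip) (+-*-Solver.solve 4 (λ j jc s f → (j +-*-Solver.:* jc) +-*-Solver.:* (s +-*-Solver.:* f) +-*-Solver.:= (j +-*-Solver.:* s) +-*-Solver.:* (jc +-*-Solver.:* f)) refl j (j ^ c) (suc c) (c !)) ⟩
      emb (recip ((j ℕ.* suc c) ℕ.* (j ^ c ℕ.* c !)))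
        ≡⟨ cong emb (trans (recip-* (j ℕ.* suc c) (j ^ c ℕ.* c !)) (cong (ℚ._* recip (j ^ c ℕ.* c !)) (recip-* j (suc c)))) ⟩
      emb ((recip j ℚ.* recip (suc c)) ℚ.* recip (j ^ c ℕ.* c !))
        ≡⟨ trans (emb-* _ _) (cong (_* r) (emb-* _ _)) ⟩
      (emb (recip j) * emb (recip (suc c))) * r ∎

  -- Here `d` is the weight already spent on shorter cycles. Counting it up to `k` avoids a
  -- truncated `k ∸ d`; multiplicities run up to `k` as in `cycleTypes`.
  Q : (o n d : ℕ) → Carrier
  Q o zero    d = if does (d ℕ.≟ k) then 1# else 0#
  Q o (suc n) d = sum {suc k} (λ i → α (suc o) (toℕ i) * Q (suc o) n (d ℕ.+ suc o ℕ.* toℕ i))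

  Q-beyond : ∀ o n d → k < d → Q o n d ≡ 0#
  Q-beyond o zero    d k<d rewrite dec-false (d ℕ.≟ k) (λ { refl → ℕₚ.<-irrefl refl k<d }) = refl
  Q-beyond o (suc n) d k<d = trans
    (sum-cong-≗ {suc k} λ i → trans (cong (α (suc o) (toℕ i) *_) (Q-beyond (suc o) n _ (ℕₚ.<-≤-trans k<d (ℕₚ.m≤m+n d (suc o ℕ.* toℕ i))))) (zeroʳ _))
    (sum-replicate-zero (suc k))

  Q-top : ∀ o n → Q o n k ≡ 1#
  Q-top o zero rewrite dec-true (k ℕ.≟ k) refl = refl
  Q-top o (suc n) = trans (cong₂ _+_ first (trans (sum-cong-≗ {k} rest) (sum-replicate-zero k))) (+-identityʳ 1#)
    where
    first : α (suc o) 0 * Q (suc o) n (k ℕ.+ suc o ℕ.* 0) ≡ 1#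
    first = trans (cong₂ _*_ (α-zero (suc o))
      (trans (cong (Q (suc o) n) (trans (cong (k ℕ.+_) (ℕₚ.*-zeroʳ (suc o))) (ℕₚ.+-identityʳ k))) (Q-top (suc o) n))) (*-identityʳ 1#)
    rest : ∀ i → α (suc o) (suc (toℕ i)) * Q (suc o) n (k ℕ.+ suc o ℕ.* suc (toℕ i)) ≡ 0#
    rest i = trans (cong (α (suc o) (suc (toℕ i)) *_) (Q-beyond (suc o) n _ (ℕₚ.m<m+n k (s≤s z≤n)))) (zeroʳ _)

  -- The sum of `t (j + i) * f (d + i)` over i < n. For f = `Q o n` it is a coefficient of the
  -- series multiplied by Σ_j t_j x^j, its logarithmic derivative.
  U : (f : ℕ → Carrier) (j n d : ℕ) → Carrier
  U f j zero    d = 0#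
  U f j (suc n) d = t j * f d + U f (suc j) n (suc d)

  private
    -- `U` is linear in `f` and commutes with shifts of `d`; hence it passes through the expansion
    -- of `Q o (suc n)` into shifted copies of `Q (suc o) n`.
    U-sum : ∀ {m} (a : Fin m → Carrier) (f : Fin m → ℕ → Carrier) (s : Fin m → ℕ) (g : ℕ → Carrier) →
      (∀ d → g d ≡ sum (λ i → a i * f i (d ℕ.+ s i))) → ∀ j n d →
      sum (λ i → a i * U (f i) j n (d ℕ.+ s i)) ≡ U g j n d
    U-sum {m} a f s g g≡ j zero d = trans (sum-cong-≗ λ i → zeroʳ (a i)) (sum-replicate-zero m)
    U-sum {m} a f s g g≡ j (suc n) d = begin
      sum (λ i → a i * (t j * f i (d ℕ.+ s i) + U (f i) (suc j) n (suc d ℕ.+ s i)))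
        ≡⟨ sum-cong-≗ (λ i → solve 4 (λ a t f u → a :* (t :* f :+ u) := t :* (a :* f) :+ a :* u) refl (a i) (t j) (f i (d ℕ.+ s i)) (U (f i) (suc j) n (suc d ℕ.+ s i))) ⟩
      sum (λ i → t j * (a i * f i (d ℕ.+ s i)) + a i * U (f i) (suc j) n (suc d ℕ.+ s i))
        ≡⟨ ∑-distrib-+ (λ i → t j * (a i * f i (d ℕ.+ s i))) _ ⟩
      sum (λ i → t j * (a i * f i (d ℕ.+ s i))) + sum (λ i → a i * U (f i) (suc j) n (suc d ℕ.+ s i))
        ≡⟨ cong₂ _+_ (sym (*-distribˡ-sum (t j) (λ i → a i * f i (d ℕ.+ s i)))) (U-sum a f s g g≡ (suc j) n (suc d)) ⟩
      t j * sum (λ i → a i * f i (d ℕ.+ s i)) + U g (suc j) n (suc d)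
        ≡⟨ cong (λ x → t j * x + U g (suc j) n (suc d)) (sym (g≡ d)) ⟩
      t j * g d + U g (suc j) n (suc d) ∎
      where open Solver

  -- Logarithmic derivative of the exponential formula.
  Q-recurrence : ∀ o n d → (ν k - ν d) * Q o n d ≡ U (Q o n) (suc o) n (suc o ℕ.+ d)
  Q-recurrence o zero d with d ℕ.≟ k
  ... | yes refl = trans (cong (_* Q o zero d) (-‿inverseʳ (ν d))) (zeroˡ _)
  ... | no d≢k rewrite dec-false (d ℕ.≟ k) d≢k = zeroʳ _
  Q-recurrence o (suc n) d = begin
    (ν k - ν d) * sum {suc k} (λ i → a i * R (d ℕ.+ s i))
      ≡⟨ *-distribˡ-sum (ν k - ν d) (λ i → a i * R (d ℕ.+ s i)) ⟩
    sum {suc k} (λ i → (ν k - ν d) * (a i * R (d ℕ.+ s i)))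
      -- Product rule: `k - d` splits into `k - (d + s)`, the weight left to the longer cycles, and
      -- `s`, the weight of the present length.
      ≡⟨ sum-cong-≗ {suc k} (λ i → trans
           (solve 5 (λ k d s a r → (k :- d) :* (a :* r) := a :* ((k :- (d :+ s)) :* r) :+ (s :* a) :* r) refl (ν k) (ν d) (ν (s i)) (a i) (R (d ℕ.+ s i)))
           (cong (λ x → a i * ((ν k - x) * R (d ℕ.+ s i)) + (ν (s i) * a i) * R (d ℕ.+ s i)) (sym (ν-+ d (s i))))) ⟩
    sum {suc k} (λ i → a i * ((ν k - ν (d ℕ.+ s i)) * R (d ℕ.+ s i)) + (ν (s i) * a i) * R (d ℕ.+ s i))
      ≡⟨ ∑-distrib-+ {suc k} (λ i → a i * ((ν k - ν (d ℕ.+ s i)) * R (d ℕ.+ s i))) (λ i → (ν (s i) * a i) * R (d ℕ.+ s i)) ⟩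
    sum {suc k} (λ i → a i * ((ν k - ν (d ℕ.+ s i)) * R (d ℕ.+ s i))) + sum {suc k} (λ i → (ν (s i) * a i) * R (d ℕ.+ s i))
      ≡⟨ cong₂ _+_ other-parts this-part ⟩
    U (Q o (suc n)) (suc (suc o)) n (suc (suc o ℕ.+ d)) + t (suc o) * Q o (suc n) (suc o ℕ.+ d)
      ≡⟨ +-comm _ _ ⟩
    t (suc o) * Q o (suc n) (suc o ℕ.+ d) + U (Q o (suc n)) (suc (suc o)) n (suc (suc o ℕ.+ d)) ∎
    where
    open Solver
    a : Fin (suc k) → Carrier
    a i = α (suc o) (toℕ i)
    s : Fin (suc k) → ℕ
    s i = suc o ℕ.* toℕ i
    R : ℕ → Carrier
    R = Q (suc o) n
    other-parts : sum {suc k} (λ i → a i * ((ν k - ν (d ℕ.+ s i)) * R (d ℕ.+ s i))) ≡ U (Q o (suc n)) (suc (suc o)) n (suc (suc o ℕ.+ d))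
    other-parts = trans (sum-cong-≗ {suc k} λ i → cong (a i *_)
        (trans (Q-recurrence (suc o) n (d ℕ.+ s i)) (cong (U R (suc (suc o)) n) (sym (ℕₚ.+-assoc (suc (suc o)) d (s i))))))
      (U-sum a (λ _ → R) s (Q o (suc n)) (λ _ → refl) (suc (suc o)) n (suc (suc o ℕ.+ d)))
    shift : ∀ c → d ℕ.+ suc o ℕ.* suc c ≡ (suc o ℕ.+ d) ℕ.+ suc o ℕ.* c
    shift c = +-*-Solver.solve 3 (λ d j c → d +-*-Solver.:+ j +-*-Solver.:* (+-*-Solver.con 1 +-*-Solver.:+ c) +-*-Solver.:= (j +-*-Solver.:+ d) +-*-Solver.:+ j +-*-Solver.:* c) refl d (suc o) c
    X : ℕ → Carrier
    X c = α (suc o) c * R ((suc o ℕ.+ d) ℕ.+ suc o ℕ.* c)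
    -- Lowering the multiplicity by one leaves it running below `k`. The missing index `c = k` has
    -- weight beyond `k`, so adding it restores the full sum.
    last-vanishes : X k ≡ 0#
    last-vanishes = trans (cong (α (suc o) k *_) (Q-beyond (suc o) n _
      (s≤s (ℕₚ.≤-trans (ℕₚ.m≤m+n k (o ℕ.* k)) (ℕₚ.m≤n+m (suc o ℕ.* k) (o ℕ.+ d)))))) (zeroʳ _)
    this-part : sum {suc k} (λ i → (ν (s i) * a i) * R (d ℕ.+ s i)) ≡ t (suc o) * Q o (suc n) (suc o ℕ.+ d)
    this-part = begin
      (ν (suc o ℕ.* 0) * α (suc o) 0) * R (d ℕ.+ suc o ℕ.* 0) + sum {k} (λ i → (ν (suc o ℕ.* suc (toℕ i)) * α (suc o) (suc (toℕ i))) * R (d ℕ.+ suc o ℕ.* suc (toℕ i)))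
        ≡⟨ cong₂ _+_ (trans (cong (λ m → (ν m * α (suc o) 0) * R (d ℕ.+ suc o ℕ.* 0)) (ℕₚ.*-zeroʳ (suc o))) (trans (cong (_* R (d ℕ.+ suc o ℕ.* 0)) (zeroˡ _)) (zeroˡ _)))
             (sum-cong-≗ {k} λ i → trans (cong₂ _*_ (α-suc o (toℕ i)) (cong R (shift (toℕ i)))) (*-assoc _ _ _)) ⟩
      0# + sum {k} (λ i → t (suc o) * X (toℕ i))
        ≡⟨ trans (+-identityˡ _) (sym (*-distribˡ-sum {k} (t (suc o)) (X ∘ toℕ))) ⟩
      t (suc o) * sum {k} (X ∘ toℕ)
        ≡⟨ cong (t (suc o) *_) (sym (trans (sum-init-last {k} (X ∘ toℕ)) (trans
             (cong₂ _+_ (sum-cong-≗ {k} (λ i → cong X (Finₚ.toℕ-inject₁ i))) (trans (cong X (Finₚ.toℕ-fromℕ k)) last-vanishes)) (+-identityʳ _)))) ⟩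
      t (suc o) * sum {suc k} (X ∘ toℕ) ∎

  -- The statement's `weight` runs over `allFin` and does not recurse on the vector. The offset `o`
  -- lets the tail of a vector keep its cycle lengths.
  weightFrom : ∀ o {n} → Vec ℕ n → ℕ
  weightFrom o []       = 0
  weightFrom o (c ∷ cs) = suc o ℕ.* c ℕ.+ weightFrom (suc o) cs

  valueFrom : ∀ o {n} → Vec ℕ n → Carrier
  valueFrom o []       = 1#
  valueFrom o (c ∷ cs) = α (suc o) c * valueFrom (suc o) cs

  -- Grouping the vectors by their first entry, the multiplicity of length o + 1, pulls one factor
  -- `α` out of each group; this is the recursion of `Q`.
  Q-as-sum : ∀ o n d → Σᴸ (λ c → if does (d ℕ.+ weightFrom o c ℕ.≟ k) then valueFrom o c else 0#) (allVecs n (suc k)) ≡ Q o n d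
  Q-as-sum o zero d = trans (+-identityʳ _) (cong (λ m → if does (m ℕ.≟ k) then 1# else 0#) (ℕₚ.+-identityʳ d))
  Q-as-sum o (suc n) d = begin
    Σᴸ φ (concatMap (λ c → List.map (c ∷_) (allVecs n (suc k))) (upTo (suc k)))
      ≡⟨ Σᴸ-concatMap φ (λ c → List.map (c ∷_) (allVecs n (suc k))) (upTo (suc k)) ⟩
    Σᴸ (λ c → Σᴸ φ (List.map (c ∷_) (allVecs n (suc k)))) (upTo (suc k))
      ≡⟨ Σᴸ-applyUpTo (λ c → Σᴸ φ (List.map (c ∷_) (allVecs n (suc k)))) id (suc k) ⟩
    sum {suc k} (λ i → Σᴸ φ (List.map (toℕ i ∷_) (allVecs n (suc k))))
      ≡⟨ sum-cong-≗ {suc k} (λ i → fibre (toℕ i)) ⟩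
    Q o (suc n) d ∎
    where
    φ : Vec ℕ (suc n) → Carrier
    φ c = if does (d ℕ.+ weightFrom o c ℕ.≟ k) then valueFrom o c else 0#
    pull : ∀ b (x y : Carrier) → (if b then x * y else 0#) ≡ x * (if b then y else 0#)
    pull true  x y = refl
    pull false x y = sym (zeroʳ x)
    fibre : ∀ c → Σᴸ φ (List.map (c ∷_) (allVecs n (suc k))) ≡ α (suc o) c * Q (suc o) n (d ℕ.+ suc o ℕ.* c)
    fibre c = begin
      Σᴸ φ (List.map (c ∷_) (allVecs n (suc k)))
        ≡⟨ Σᴸ-map φ (c ∷_) (allVecs n (suc k)) ⟩
      Σᴸ (λ cs → φ (c ∷ cs)) (allVecs n (suc k))
        ≡⟨ Σᴸ-cong (λ cs → trans
             (cong (λ m → if does (m ℕ.≟ k) then α (suc o) c * valueFrom (suc o) cs else 0#) (sym (ℕₚ.+-assoc d (suc o ℕ.* c) (weightFrom (suc o) cs))))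
             (pull (does ((d ℕ.+ suc o ℕ.* c) ℕ.+ weightFrom (suc o) cs ℕ.≟ k)) (α (suc o) c) (valueFrom (suc o) cs))) (allVecs n (suc k)) ⟩
      Σᴸ (λ cs → α (suc o) c * (if does ((d ℕ.+ suc o ℕ.* c) ℕ.+ weightFrom (suc o) cs ℕ.≟ k) then valueFrom (suc o) cs else 0#)) (allVecs n (suc k))
        ≡⟨ Σᴸ-* (α (suc o) c) _ (allVecs n (suc k)) ⟩
      α (suc o) c * Σᴸ (λ cs → if does ((d ℕ.+ suc o ℕ.* c) ℕ.+ weightFrom (suc o) cs ℕ.≟ k) then valueFrom (suc o) cs else 0#) (allVecs n (suc k))
        ≡⟨ cong (α (suc o) c *_) (Q-as-sum (suc o) n (d ℕ.+ suc o ℕ.* c)) ⟩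
      α (suc o) c * Q (suc o) n (d ℕ.+ suc o ℕ.* c) ∎

  weight≡ : ∀ {n} (c : Vec ℕ n) → weight c ≡ weightFrom 0 c
  weight≡ c = trans (cong ListAction.sum (Listₚ.map-tabulate id (λ i → suc (toℕ i) ℕ.* Vec.lookup c i))) (go 0 c)
    where
    go : ∀ o {n} (c : Vec ℕ n) → ListAction.sum (tabulate (λ i → suc (o ℕ.+ toℕ i) ℕ.* Vec.lookup c i)) ≡ weightFrom o c
    go o []       = refl
    go o (c ∷ cs) = cong₂ ℕ._+_ (cong (λ m → suc m ℕ.* c) (ℕₚ.+-identityʳ o))
      (trans (cong ListAction.sum (Listₚ.tabulate-cong (λ i → cong (λ m → suc m ℕ.* Vec.lookup cs i) (ℕₚ.+-suc o (toℕ i))))) (go (suc o) cs))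

  value≡ : ∀ {n} (c : Vec ℕ n) →
    emb (recip (ListAction.product (List.map (λ i → (suc (toℕ i) ^ Vec.lookup c i) ℕ.* (Vec.lookup c i !)) (allFin n)))) *
      foldr _*_ 1# (List.map (λ i → tpow (suc (toℕ i)) (Vec.lookup c i)) (allFin n))
    ≡ valueFrom 0 c
  value≡ c = trans (cong₂ (λ x y → emb (recip (ListAction.product x)) * foldr _*_ 1# y)
      (Listₚ.map-tabulate id (λ i → (suc (toℕ i) ^ Vec.lookup c i) ℕ.* (Vec.lookup c i !)))
      (Listₚ.map-tabulate id (λ i → tpow (suc (toℕ i)) (Vec.lookup c i)))) (go 0 c)
    where
    open Solver
    go : ∀ o {n} (c : Vec ℕ n) →
      emb (recip (ListAction.product (tabulate (λ i → (suc (o ℕ.+ toℕ i) ^ Vec.lookup c i) ℕ.* (Vec.lookup c i !))))) *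
        foldr _*_ 1# (tabulate (λ i → tpow (suc (o ℕ.+ toℕ i)) (Vec.lookup c i)))
      ≡ valueFrom o c
    go o []       = *-identityˡ 1#
    go o (c ∷ cs) = begin
      emb (recip (((suc (o ℕ.+ 0) ^ c) ℕ.* (c !)) ℕ.* P)) * (tpow (suc (o ℕ.+ 0)) c * T)
        ≡⟨ cong (λ m → emb (recip (((suc m ^ c) ℕ.* (c !)) ℕ.* P)) * (tpow (suc m) c * T)) (ℕₚ.+-identityʳ o) ⟩
      emb (recip (((suc o ^ c) ℕ.* (c !)) ℕ.* P)) * (tpow (suc o) c * T)
        ≡⟨ cong (_* (tpow (suc o) c * T)) (trans (cong emb (recip-* ((suc o ^ c) ℕ.* (c !)) P)) (emb-* _ _)) ⟩
      (emb (recip ((suc o ^ c) ℕ.* (c !))) * emb (recip P)) * (tpow (suc o) c * T)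
        ≡⟨ solve 4 (λ a b x y → (a :* b) :* (x :* y) := (a :* x) :* (b :* y)) refl (emb (recip ((suc o ^ c) ℕ.* (c !)))) (emb (recip P)) (tpow (suc o) c) T ⟩
      α (suc o) c * (emb (recip P) * T)
        ≡⟨ cong (α (suc o) c *_) (trans (cong₂ (λ x y → emb (recip (ListAction.product x)) * foldr _*_ 1# y)
             (Listₚ.tabulate-cong (λ i → cong (λ m → (suc m ^ Vec.lookup cs i) ℕ.* (Vec.lookup cs i !)) (ℕₚ.+-suc o (toℕ i))))
             (Listₚ.tabulate-cong (λ i → cong (λ m → tpow (suc m) (Vec.lookup cs i)) (ℕₚ.+-suc o (toℕ i))))) (go (suc o) cs)) ⟩
      α (suc o) c * valueFrom (suc o) cs ∎
      where
      P = ListAction.product (tabulate (λ i → (suc (o ℕ.+ suc (toℕ i)) ^ Vec.lookup cs i) ℕ.* (Vec.lookup cs i !)))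
      T = foldr _*_ 1# (tabulate (λ i → tpow (suc (o ℕ.+ suc (toℕ i))) (Vec.lookup cs i)))

  -- For `tpow j c` equal to `tval F p b u v w j ^^ c` this is the summand of `A` by computation.
  -- That is why powers are a parameter of the module.
  tproduct cycleIndexTerm : Vec ℕ k → Carrier
  tproduct c       = foldr _*_ 1# (List.map (λ i → tpow (suc (toℕ i)) (Vec.lookup c i)) (allFin k))
  cycleIndexTerm c = emb (Ncount c) * tproduct c

  cycleIndex≡Q : Σᴸ cycleIndexTerm (cycleTypes k) ≡ ν (k !) * Q 0 k 0
  cycleIndex≡Q = begin
    Σᴸ cycleIndexTerm (cycleTypes k)
      ≡⟨ Σᴸ-cong (λ c → trans (cong (_* tproduct c) (emb-* _ _)) (trans (*-assoc _ _ _) (cong (ν (k !) *_) (value≡ c)))) (cycleTypes k) ⟩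
    Σᴸ (λ c → ν (k !) * valueFrom 0 c) (cycleTypes k)
      ≡⟨ Σᴸ-* (ν (k !)) (valueFrom 0) (cycleTypes k) ⟩
    ν (k !) * Σᴸ (valueFrom 0) (cycleTypes k)
      ≡⟨ cong (ν (k !) *_) (trans (Σᴸ-filter (λ c → weight c ℕ.≟ k) (valueFrom 0) (allVecs k (suc k)))
           (trans (Σᴸ-cong (λ c → cong (λ m → if does (m ℕ.≟ k) then valueFrom 0 c else 0#) (weight≡ c)) (allVecs k (suc k)))
                  (Q-as-sum 0 k 0))) ⟩
    ν (k !) * Q 0 k 0 ∎

-- Newton's identities for signed sums over sets of squares.

module SubsetSums (𝓐 : ℚ-Algebra) {q : ℕ} (F : FiniteField q) where
  open ℚ-Algebra 𝓐
  open Solver using (solve; _:=_; _:+_; _:*_; _:-_; :-_; con)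
  open ≡-Reasoning
  module K = FieldTheory F
  open FiniteField F using () renaming (_+_ to infixl 6 _⊞_; _*_ to infixl 7 _⊠_; 0# to 0ᶠ; 1# to 1ᶠ)
  open K using (Sq; Sq?; sq; δ)

  W : Fin q → Carrier
  W x = ν (sq x)

  W-yes : ∀ {x} → Sq x → W x ≡ 1#
  W-yes s = cong ν (K.sq-yes s)

  W-no : ∀ {x} → ¬ Sq x → W x ≡ 0#
  W-no ¬s = cong ν (K.sq-no ¬s)

  W-idem : ∀ x → W x * W x ≡ W x
  W-idem x with K.quadraticType x
  ... | K.isSquare s       rewrite W-yes s = *-identityˡ 1#
  ... | K.isNonsquare _ ¬s rewrite W-no ¬s = zeroˡ 0#
  ... | K.isZero refl      rewrite K.sq-0 = zeroˡ 0#

  ⊞-swap : ∀ x y z → (x ⊞ y) ⊞ z ≡ (x ⊞ z) ⊞ y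
  ⊞-swap x y z = trans (K.+-assoc x y z) (trans (cong (x ⊞_) (K.+-comm y z)) (sym (K.+-assoc x z y)))

  -- (-1)^k times the sum of G (y + Σ_{i∈I} v i) over the k-subsets I with all v i (i ∈ I) squares.
  e : (G : Fin q → Carrier) → ∀ {n} → (Fin n → Fin q) → ℕ → Fin q → Carrier
  e G {zero}  v zero    y = G y
  e G {zero}  v (suc k) y = 0#
  e G {suc n} v zero    y = e G (v ∘ suc) zero y
  e G {suc n} v (suc k) y = e G (v ∘ suc) (suc k) y - W (v zero) * e G (v ∘ suc) k (y ⊞ v zero)

  e-zero : ∀ G {n} (v : Fin n → Fin q) y → e G v 0 y ≡ G y
  e-zero G {zero}  v y = refl
  e-zero G {suc n} v y = e-zero G (v ∘ suc) y

  -- S f a j k y = Σ_{i<k} f_{k-1-i}(y + (j+i) a)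
  S : (ℕ → Fin q → Carrier) → Fin q → (j k : ℕ) → Fin q → Carrier
  S f a j zero    y = 0#
  S f a j (suc k) y = f k (y ⊞ ι F j ⊠ a) + S f a (suc j) k y

  module _ (G : Fin q → Carrier) where

    private
      -- The recursion of `e` is applied in every term of `S`. It has no second part in degree zero,
      -- so the subtracted `S` is one term shorter.
      S-head : ∀ {n} (v : Fin (suc n) → Fin q) h j k y →
        S (e G v) h j (suc k) y ≡ S (e G (v ∘ suc)) h j (suc k) y - W (v zero) * S (e G (v ∘ suc)) h j k (y ⊞ v zero)
      S-head v h j zero y =
        solve 2 (λ x w → x :+ con 0ℚ := (x :+ con 0ℚ) :- w :* con 0ℚ) refl _ (W (v zero))
      S-head v h j (suc k) y = trans
        (cong₂ _+_ (cong (λ z → e G (v ∘ suc) (suc k) (y ⊞ ι F j ⊠ h) - W (v zero) * e G (v ∘ suc) k z) (⊞-swap y (ι F j ⊠ h) (v zero)))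
                   (S-head v h (suc j) k y))
        (solve 5 (λ x w x′ s s′ → (x :- w :* x′) :+ (s :- w :* s′) := (x :+ s) :- w :* (x′ :+ s′)) refl
          (e G (v ∘ suc) (suc k) (y ⊞ ι F j ⊠ h)) (W (v zero)) (e G (v ∘ suc) k ((y ⊞ v zero) ⊞ ι F j ⊠ h))
          (S (e G (v ∘ suc)) h (suc j) (suc k) y) (S (e G (v ∘ suc)) h (suc j) k (y ⊞ v zero)))

      ι-step : ∀ y j a → (y ⊞ ι F j ⊠ a) ⊞ a ≡ y ⊞ ι F (suc j) ⊠ a
      ι-step y j a = trans (K.+-assoc y _ a) (cong (y ⊞_) (trans (K.+-comm _ a)
        (sym (trans (K.distribʳ a 1ᶠ (ι F j)) (cong (_⊞ ι F j ⊠ a) (K.*-identityˡ a))))))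

      -- Expanding `e G v` at its own first point `v zero` makes the subtracted part of each term
      -- cancel the leading part of the next, because `W` is idempotent. Only the leading part of
      -- the first term survives.
      S-telescope : ∀ {n} (v : Fin (suc n) → Fin q) j k y →
        W (v zero) * S (e G v) (v zero) j (suc k) y ≡ W (v zero) * e G (v ∘ suc) k (y ⊞ ι F j ⊠ v zero)
      S-telescope v j zero    y = cong (W (v zero) *_) (+-identityʳ _)
      S-telescope v j (suc k) y = begin
        w * ((x - w * e G (v ∘ suc) k ((y ⊞ ι F j ⊠ a) ⊞ a)) + S (e G v) a (suc j) (suc k) y)
          ≡⟨ cong (λ z → w * ((x - w * e G (v ∘ suc) k z) + S (e G v) a (suc j) (suc k) y)) (ι-step y j a) ⟩
        w * ((x - w * x′) + S (e G v) a (suc j) (suc k) y)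
          ≡⟨ solve 4 (λ w x x′ s → w :* ((x :- w :* x′) :+ s) := (w :* x :- (w :* w) :* x′) :+ w :* s) refl w x x′ (S (e G v) a (suc j) (suc k) y) ⟩
        (w * x - (w * w) * x′) + w * S (e G v) a (suc j) (suc k) y
          ≡⟨ cong₂ (λ ww s → (w * x - ww * x′) + s) (W-idem a) (S-telescope v (suc j) k y) ⟩
        (w * x - w * x′) + w * x′
          ≡⟨ solve 3 (λ w x x′ → (w :* x :- w :* x′) :+ w :* x′ := w :* x) refl w x x′ ⟩
        w * x ∎
        where
        a = v zero
        w = W a
        x = e G (v ∘ suc) (suc k) (y ⊞ ι F j ⊠ a)
        x′ = e G (v ∘ suc) k (y ⊞ ι F (suc j) ⊠ a)

    -- The j-th power sum acts here by shifting `y` by j times `v i`, summed over i. Induction adds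
    -- one point: `S-telescope` evaluates what the new point contributes, and `S-head` shows how it
    -- changes the contributions of the others.
    newton : ∀ {n} (v : Fin n → Fin q) k y → ν k * e G v k y ≡ - sum (λ i → W (v i) * S (e G v) (v i) 1 k y)
    newton {n}     v zero    y = trans (zeroˡ _) (trans (solve 0 (con 0ℚ := :- con 0ℚ) refl)
      (cong -_ (sym (trans (sum-cong-≗ {n} (λ i → zeroʳ _)) (sum-replicate-zero n)))))
    newton {zero}  v (suc k) y = trans (zeroʳ _) (solve 0 (con 0ℚ := :- con 0ℚ) refl)
    newton {suc n} v (suc k) y = begin
      ν (suc k) * (x - w * x′)
        ≡⟨ solve 4 (λ m x w x′ → m :* (x :- w :* x′) := m :* x :- w :* (m :* x′)) refl (ν (suc k)) x w x′ ⟩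
      ν (suc k) * x - w * (ν (suc k) * x′)
        -- Of the `suc k` copies of `x′`, `k` are covered by the induction hypothesis; the extra one
        -- is the share of the new point `a`.
        ≡⟨ cong₂ (λ a b → a - w * b) (newton v′ (suc k) y) (trans (cong (_* x′) (ν-+ 1 k))
             (trans (solve 2 (λ m x → (con 1ℚ :+ m) :* x := x :+ m :* x) refl (ν k) x′) (cong (x′ +_) (newton v′ k (y ⊞ a))))) ⟩
      - Σ₁ - w * (x′ - Σ₂)
        ≡⟨ solve 4 (λ s₁ w x s₂ → :- s₁ :- w :* (x :- s₂) := :- (w :* x :+ (s₁ :+ (:- w) :* s₂))) refl Σ₁ w x′ Σ₂ ⟩
      - (w * x′ + (Σ₁ + - w * Σ₂))
        ≡⟨ cong -_ (cong₂ _+_ (trans (cong (λ z → w * e G v′ k z) (cong (y ⊞_) (sym one-a))) (sym (S-telescope v 1 k y))) tail-sum) ⟩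
      - (w * S (e G v) a 1 (suc k) y + sum (λ i → W (v′ i) * S (e G v) (v′ i) 1 (suc k) y)) ∎
      where
      v′ = v ∘ suc
      a = v zero
      w = W a
      x = e G v′ (suc k) y
      x′ = e G v′ k (y ⊞ a)
      Σ₁ = sum (λ i → W (v′ i) * S (e G v′) (v′ i) 1 (suc k) y)
      Σ₂ = sum (λ i → W (v′ i) * S (e G v′) (v′ i) 1 k (y ⊞ a))
      one-a : ι F 1 ⊠ a ≡ a
      one-a = trans (cong (_⊠ a) (K.+-identityʳ 1ᶠ)) (K.*-identityˡ a)
      tail-sum : Σ₁ + - w * Σ₂ ≡ sum (λ i → W (v′ i) * S (e G v) (v′ i) 1 (suc k) y)
      tail-sum = begin
        Σ₁ + - w * Σ₂
          ≡⟨ cong (Σ₁ +_) (*-distribˡ-sum (- w) (λ i → W (v′ i) * S (e G v′) (v′ i) 1 k (y ⊞ a))) ⟩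
        Σ₁ + sum (λ i → - w * (W (v′ i) * S (e G v′) (v′ i) 1 k (y ⊞ a)))
          ≡⟨ sym (∑-distrib-+ (λ i → W (v′ i) * S (e G v′) (v′ i) 1 (suc k) y) (λ i → - w * (W (v′ i) * S (e G v′) (v′ i) 1 k (y ⊞ a)))) ⟩
        sum (λ i → W (v′ i) * S (e G v′) (v′ i) 1 (suc k) y + - w * (W (v′ i) * S (e G v′) (v′ i) 1 k (y ⊞ a)))
          ≡⟨ sum-cong-≗ (λ i → trans
               (solve 4 (λ u s w s′ → u :* s :+ (:- w) :* (u :* s′) := u :* (s :- w :* s′)) refl (W (v′ i)) (S (e G v′) (v′ i) 1 (suc k) y) w (S (e G v′) (v′ i) 1 k (y ⊞ a)))
               (cong (W (v′ i) *_) (sym (S-head v (v′ i) 1 k y)))) ⟩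
        sum (λ i → W (v′ i) * S (e G v) (v′ i) 1 (suc k) y) ∎

  -- Up to normalisation this is the functional equation of a spherical function for H acting on the
  -- field by multiplication: summing over the shifts by c H multiplies `G` by `G c`.
  module Spherical (G : Fin q → Carrier) (spherical : ∀ x c → sum (λ z → W z * G (x ⊞ c ⊠ z)) ≡ G c * G x) where

    -- `e G v k` is a combination of translates of `G`, and translations commute with the sum over c
    -- H, so the eigenvalue is inherited.
    e-spherical : ∀ {n} (v : Fin n → Fin q) k y c → sum (λ z → W z * e G v k (y ⊞ c ⊠ z)) ≡ G c * e G v k y
    e-spherical {zero}  v zero    y c = spherical y c
    e-spherical {zero}  v (suc k) y c = trans (trans (sum-cong-≗ {q} (λ z → zeroʳ _)) (sum-replicate-zero q)) (sym (zeroʳ _))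
    e-spherical {suc n} v zero    y c = e-spherical (v ∘ suc) zero y c
    e-spherical {suc n} v (suc k) y c = begin
      sum (λ z → W z * (e G v′ (suc k) (y ⊞ c ⊠ z) - w * e G v′ k ((y ⊞ c ⊠ z) ⊞ a)))
        ≡⟨ sum-cong-≗ (λ z → trans
             (solve 4 (λ u x w x′ → u :* (x :- w :* x′) := u :* x :+ (:- w) :* (u :* x′)) refl (W z) (e G v′ (suc k) (y ⊞ c ⊠ z)) w (e G v′ k ((y ⊞ c ⊠ z) ⊞ a)))
             (cong (λ x → W z * e G v′ (suc k) (y ⊞ c ⊠ z) + - w * (W z * e G v′ k x)) (⊞-swap y (c ⊠ z) a))) ⟩
      sum (λ z → W z * e G v′ (suc k) (y ⊞ c ⊠ z) + - w * (W z * e G v′ k ((y ⊞ a) ⊞ c ⊠ z)))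
        ≡⟨ ∑-distrib-+ (λ z → W z * e G v′ (suc k) (y ⊞ c ⊠ z)) (λ z → - w * (W z * e G v′ k ((y ⊞ a) ⊞ c ⊠ z))) ⟩
      sum (λ z → W z * e G v′ (suc k) (y ⊞ c ⊠ z)) + sum (λ z → - w * (W z * e G v′ k ((y ⊞ a) ⊞ c ⊠ z)))
        ≡⟨ cong₂ _+_ (e-spherical v′ (suc k) y c) (trans (sym (*-distribˡ-sum (- w) (λ z → W z * e G v′ k ((y ⊞ a) ⊞ c ⊠ z)))) (cong (- w *_) (e-spherical v′ k (y ⊞ a) c))) ⟩
      G c * e G v′ (suc k) y + - w * (G c * e G v′ k (y ⊞ a))
        ≡⟨ solve 4 (λ g x w x′ → g :* x :+ (:- w) :* (g :* x′) := g :* (x :- w :* x′)) refl (G c) (e G v′ (suc k) y) w (e G v′ k (y ⊞ a)) ⟩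
      G c * (e G v′ (suc k) y - w * e G v′ k (y ⊞ a)) ∎
      where
      v′ = v ∘ suc
      a = v zero
      w = W a

    -- The convolution in Newton's identities, with every power sum replaced by its eigenvalue.
    T : (ℕ → Carrier) → (j k : ℕ) → Carrier
    T f j zero    = 0#
    T f j (suc k) = G (ι F j) * f k + T f (suc j) k

    sum-S : ∀ {n} (v : Fin n → Fin q) j k y → sum (λ z → W z * S (e G v) z j k y) ≡ T (λ m → e G v m y) j k
    sum-S v j zero    y = trans (sum-cong-≗ {q} (λ z → zeroʳ _)) (sum-replicate-zero q)
    sum-S v j (suc k) y = begin
      sum (λ z → W z * (e G v k (y ⊞ ι F j ⊠ z) + S (e G v) z (suc j) k y))
        ≡⟨ sum-cong-≗ (λ z → distribˡ (W z) _ _) ⟩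
      sum (λ z → W z * e G v k (y ⊞ ι F j ⊠ z) + W z * S (e G v) z (suc j) k y)
        ≡⟨ ∑-distrib-+ (λ z → W z * e G v k (y ⊞ ι F j ⊠ z)) (λ z → W z * S (e G v) z (suc j) k y) ⟩
      sum (λ z → W z * e G v k (y ⊞ ι F j ⊠ z)) + sum (λ z → W z * S (e G v) z (suc j) k y)
        ≡⟨ cong₂ _+_ (e-spherical v k y (ι F j)) (sum-S v (suc j) k y) ⟩
      G (ι F j) * e G v k y + T (λ m → e G v m y) (suc j) k ∎

    module _ (k : ℕ) (t : ℕ → Carrier) (tpow : ℕ → ℕ → Carrier)
      (tpow-zero : ∀ j → tpow j 0 ≡ 1#) (tpow-suc : ∀ j c → tpow j (suc c) ≡ t j * tpow j c)
      (t≡ : ∀ j → t j ≡ - G (ι F j)) where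

      open CycleIndex 𝓐 k t tpow tpow-zero tpow-suc

      private
        f : Fin q → ℕ → Carrier
        f y m = e G id m y

        -- For m + d = k, `Q 0 k d` is the coefficient of x^m, so all degrees up to `k` are compared
        -- within one cycle index of fixed `k`.
        Agree : Fin q → ℕ → Set
        Agree y m = ∀ d → m ℕ.+ d ≡ k → f y m ≡ G y * Q 0 k d

        -- The two sums match term by term since `t j` is `- G (ι F j)`. `U` may be longer than `T`;
        -- its surplus terms evaluate `Q` beyond `k` and vanish.
        T≡U : ∀ y m → (∀ {m′} → m′ < m → Agree y m′) → ∀ j n d → m ≤ n → m ℕ.+ d ≡ suc k →
              T (f y) j m ≡ - G y * U (Q 0 k) j n d
        T≡U y zero rec j n d m≤n refl = sym (trans (cong (- G y *_) (U-beyond j n (suc k) ℕₚ.≤-refl)) (zeroʳ _))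
          where
          U-beyond : ∀ j n d → k < d → U (Q 0 k) j n d ≡ 0#
          U-beyond j zero    d k<d = refl
          U-beyond j (suc n) d k<d = trans (cong₂ _+_ (trans (cong (t j *_) (Q-beyond 0 k d k<d)) (zeroʳ _))
            (U-beyond (suc j) n (suc d) (ℕₚ.m<n⇒m<1+n k<d))) (+-identityˡ 0#)
        T≡U y (suc m) rec j (suc n) d (s≤s m≤n) 1+m+d≡1+k = begin
          G (ι F j) * f y m + T (f y) (suc j) m
            ≡⟨ cong₂ (λ a b → G (ι F j) * a + b) (rec ℕₚ.≤-refl d (ℕₚ.suc-injective 1+m+d≡1+k))
                 (T≡U y m (rec ∘ ℕₚ.m<n⇒m<1+n) (suc j) n (suc d) m≤n (trans (ℕₚ.+-suc m d) 1+m+d≡1+k)) ⟩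
          G (ι F j) * (G y * Q 0 k d) + - G y * U (Q 0 k) (suc j) n (suc d)
            ≡⟨ solve 4 (λ g y x u → g :* (y :* x) :+ (:- y) :* u := (:- y) :* ((:- g) :* x :+ u)) refl (G (ι F j)) (G y) (Q 0 k d) (U (Q 0 k) (suc j) n (suc d)) ⟩
          - G y * (- G (ι F j) * Q 0 k d + U (Q 0 k) (suc j) n (suc d))
            ≡⟨ cong (λ x → - G y * (x * Q 0 k d + U (Q 0 k) (suc j) n (suc d))) (sym (t≡ j)) ⟩
          - G y * (t j * Q 0 k d + U (Q 0 k) (suc j) n (suc d)) ∎

        -- Both sides equal `G y` in degree zero and obey the same recurrence. The induction is
        -- strong because the recurrence reaches every smaller degree.
        agree : ∀ y m → Agree y m
        agree y = <-rec (Agree y) step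
          where
          step : ∀ m → (∀ {m′} → m′ < m → Agree y m′) → Agree y m
          step zero    rec d refl = trans (e-zero G id y) (sym (trans (cong (G y *_) (Q-top 0 k)) (*-identityʳ _)))
          step (suc m) rec d refl = ν-cancel m (begin
            ν (suc m) * f y (suc m)
              ≡⟨ newton G id (suc m) y ⟩
            - sum (λ z → W z * S (e G id) z 1 (suc m) y)
              ≡⟨ cong -_ (trans (sum-S id 1 (suc m) y) (T≡U y (suc m) rec 1 k (suc d) (s≤s (ℕₚ.m≤m+n m d)) (ℕₚ.+-suc (suc m) d))) ⟩
            - (- G y * U (Q 0 k) 1 k (suc d))
              ≡⟨ cong (λ x → - (- G y * x)) (sym (Q-recurrence 0 k d)) ⟩
            - (- G y * ((ν k - ν d) * Q 0 k d))
              ≡⟨ cong (λ x → - (- G y * ((x - ν d) * Q 0 k d))) (ν-+ (suc m) d) ⟩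
            - (- G y * (((ν (suc m) + ν d) - ν d) * Q 0 k d))
              ≡⟨ solve 4 (λ g m d x → :- ((:- g) :* (((m :+ d) :- d) :* x)) := m :* (g :* x)) refl (G y) (ν (suc m)) (ν d) (Q 0 k d) ⟩
            ν (suc m) * (G y * Q 0 k d) ∎)

      e≡cycleIndex : ∀ y → ν (k !) * e G id k y ≡ G y * Σᴸ cycleIndexTerm (cycleTypes k)
      e≡cycleIndex y = begin
        ν (k !) * e G id k y          ≡⟨ cong (ν (k !) *_) (agree y k 0 (ℕₚ.+-identityʳ k)) ⟩
        ν (k !) * (G y * Q 0 k 0)     ≡⟨ solve 3 (λ a b c → a :* (b :* c) := b :* (a :* c)) refl (ν (k !)) (G y) (Q 0 k 0) ⟩
        G y * (ν (k !) * Q 0 k 0)     ≡⟨ cong (G y *_) (sym cycleIndex≡Q) ⟩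
        G y * Σᴸ cycleIndexTerm (cycleTypes k) ∎

-- Binomial coefficients and `N-H` as signed subset sums.

nC0≡1 : ∀ n → n C 0 ≡ 1
nC0≡1 n = trans (nCk≡nC[n∸k] {k = 0} {n = n} z≤n) (nCn≡1 n)

module Counting (𝓐 : ℚ-Algebra) {q : ℕ} (F : FiniteField q) where
  open ℚ-Algebra 𝓐
  open Solver using (solve; _:=_; _:+_; _:*_; _:-_; :-_; con)
  open ≡-Reasoning
  open SubsetSums 𝓐 F
  open FiniteField F using () renaming (_+_ to infixl 6 _⊞_; _*_ to infixl 7 _⊠_; 0# to 0ᶠ; 1# to 1ᶠ; -_ to ⊟_)
  open K using (Sq; Sq?; sq; δ)

  sg : ℕ → Carrier
  sg k = emb (sgn k)

  sg-suc : ∀ k → sg (suc k) ≡ - sg k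
  sg-suc k = emb-neg (sgn k)

  sg-square : ∀ k → sg k * sg k ≡ 1#
  sg-square zero    = *-identityˡ 1#
  sg-square (suc k) = trans (cong₂ _*_ (sg-suc k) (sg-suc k)) (trans (solve 1 (λ s → (:- s) :* (:- s) := s :* s) refl (sg k)) (sg-square k))

  -- Pascal's rule, one point at a time: a square enlarges the pool by one, any other point changes
  -- nothing. `step` takes the indicator as a number at most one so that it can be matched on.
  e-const : ∀ {n} (v : Fin n → Fin q) k y → e (λ _ → 1#) v k y ≡ sg k * ν (sumℕ (sq ∘ v) C k)
  e-const {n}     v zero    y = trans (e-zero (λ _ → 1#) v y) (sym (trans (*-identityˡ _) (cong ν (nC0≡1 (sumℕ (sq ∘ v))))))
  e-const {zero}  v (suc k) y = sym (zeroʳ _)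
  e-const {suc n} v (suc k) y = step (sq (v zero)) (𝟙≤1 (Sq? (v zero)))
    where
    e₁ = e (λ _ → 1#) (v ∘ suc)
    m = sumℕ (sq ∘ v ∘ suc)
    step : ∀ s → s ≤ 1 → e₁ (suc k) y - ν s * e₁ k (y ⊞ v zero) ≡ sg (suc k) * ν ((s ℕ.+ m) C suc k)
    step zero       _ = trans (solve 2 (λ x y → x :- con 0ℚ :* y := x) refl (e₁ (suc k) y) (e₁ k (y ⊞ v zero))) (e-const (v ∘ suc) (suc k) y)
    step (suc zero) _ = begin
      e₁ (suc k) y - 1# * e₁ k (y ⊞ v zero)
        ≡⟨ cong₂ (λ a b → a - 1# * b) (e-const (v ∘ suc) (suc k) y) (e-const (v ∘ suc) k (y ⊞ v zero)) ⟩
      sg (suc k) * ν (m C suc k) - 1# * (sg k * ν (m C k))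
        ≡⟨ cong (λ s → s * ν (m C suc k) - 1# * (sg k * ν (m C k))) (sg-suc k) ⟩
      - sg k * ν (m C suc k) - 1# * (sg k * ν (m C k))
        ≡⟨ solve 3 (λ s a b → (:- s) :* a :- con 1ℚ :* (s :* b) := (:- s) :* (b :+ a)) refl (sg k) (ν (m C suc k)) (ν (m C k)) ⟩
      - sg k * (ν (m C k) + ν (m C suc k))
        ≡⟨ cong₂ _*_ (sym (sg-suc k)) (trans (sym (ν-+ (m C k) (m C suc k))) (cong ν (nCk+nC[k+1]≡[n+1]C[k+1] m k))) ⟩
      sg (suc k) * ν (suc m C suc k) ∎
    step (suc (suc _)) (s≤s ())

  -- Linearity of `e` in `G`, shaped for the decomposition of q [z = 0] into the two periods and the
  -- constant 1.
  e-linear : ∀ {G G₁ G₂ G₃ : Fin q → Carrier} {a} → (∀ z → a * G z ≡ (G₁ z + G₂ z) + G₃ z) →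
    ∀ {n} (v : Fin n → Fin q) k y → a * e G v k y ≡ (e G₁ v k y + e G₂ v k y) + e G₃ v k y
  e-linear hyp {zero}  v zero    y = hyp y
  e-linear {a = a} hyp {zero} v (suc k) y = solve 1 (λ a → a :* con 0ℚ := (con 0ℚ :+ con 0ℚ) :+ con 0ℚ) refl a
  e-linear hyp {suc n} v zero    y = e-linear hyp (v ∘ suc) zero y
  e-linear {G} {G₁} {G₂} {G₃} {a} hyp {suc n} v (suc k) y = begin
    a * (e G v′ (suc k) y - w * e G v′ k y′)
      ≡⟨ solve 4 (λ a x w x′ → a :* (x :- w :* x′) := a :* x :- w :* (a :* x′)) refl a (e G v′ (suc k) y) w (e G v′ k y′) ⟩
    a * e G v′ (suc k) y - w * (a * e G v′ k y′)
      ≡⟨ cong₂ (λ x x′ → x - w * x′) (e-linear hyp v′ (suc k) y) (e-linear hyp v′ k y′) ⟩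
    (e G₁ v′ (suc k) y + e G₂ v′ (suc k) y + e G₃ v′ (suc k) y) - w * (e G₁ v′ k y′ + e G₂ v′ k y′ + e G₃ v′ k y′)
      ≡⟨ solve 7 (λ w a b c a′ b′ c′ → (a :+ b :+ c) :- w :* (a′ :+ b′ :+ c′) := ((a :- w :* a′) :+ (b :- w :* b′)) :+ (c :- w :* c′)) refl
           w (e G₁ v′ (suc k) y) (e G₂ v′ (suc k) y) (e G₃ v′ (suc k) y) (e G₁ v′ k y′) (e G₂ v′ k y′) (e G₃ v′ k y′) ⟩
    ((e G₁ v′ (suc k) y - w * e G₁ v′ k y′) + (e G₂ v′ (suc k) y - w * e G₂ v′ k y′)) + (e G₃ v′ (suc k) y - w * e G₃ v′ k y′) ∎
    where
    v′ = v ∘ suc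
    w = W (v zero)
    y′ = y ⊞ v zero

  -- The share of a single subset in `e`, without the sign (-1)^k. For G = `δ₀` it is the indicator
  -- of a solution.
  val : (G : Fin q → Carrier) → ∀ {n} → (Fin n → Fin q) → ℕ → Fin q → Subset n → Carrier
  val G v zero    y []          = G y
  val G v (suc k) y []          = 0#
  val G v k       y (false ∷ I) = val G (v ∘ suc) k y I
  val G v zero    y (true ∷ I)  = 0#
  val G v (suc k) y (true ∷ I)  = W (v zero) * val G (v ∘ suc) k (y ⊞ v zero) I

  sum-val : ∀ G {n} (v : Fin n → Fin q) k y → Σᴸ (val G v k y) (allSubsets n) ≡ sg k * e G v k y
  sum-val G {zero}  v zero    y = trans (+-identityʳ _) (sym (*-identityˡ _))
  sum-val G {zero}  v (suc k) y = trans (+-identityʳ _) (sym (zeroʳ _))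
  sum-val G {suc n} v k       y = trans (Σᴸ-concatMap (val G v k y) (λ s → (false ∷ s) ∷ (true ∷ s) ∷ []) (allSubsets n))
    (trans (Σᴸ-+ (λ s → val G v k y (false ∷ s)) (λ s → val G v k y (true ∷ s) + 0#) (allSubsets n)) (split k))
    where
    v′ = v ∘ suc
    split : ∀ k → Σᴸ (λ s → val G v k y (false ∷ s)) (allSubsets n) + Σᴸ (λ s → val G v k y (true ∷ s) + 0#) (allSubsets n) ≡ sg k * e G v k y
    split zero = trans (cong₂ _+_ (sum-val G v′ zero y)
        (trans (Σᴸ-cong (λ s → trans (+-identityʳ 0#) (sym (zeroˡ 0#))) (allSubsets n)) (trans (Σᴸ-* 0# (λ _ → 0#) (allSubsets n)) (zeroˡ _))))
      (+-identityʳ _)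
    split (suc k) = begin
      Σᴸ (λ s → val G v′ (suc k) y s) (allSubsets n) + Σᴸ (λ s → W (v zero) * val G v′ k (y ⊞ v zero) s + 0#) (allSubsets n)
        ≡⟨ cong₂ _+_ (sum-val G v′ (suc k) y) (trans (Σᴸ-cong (λ s → +-identityʳ _) (allSubsets n))
             (trans (Σᴸ-* (W (v zero)) (val G v′ k (y ⊞ v zero)) (allSubsets n)) (cong (W (v zero) *_) (sum-val G v′ k (y ⊞ v zero))))) ⟩
      sg (suc k) * e G v′ (suc k) y + W (v zero) * (sg k * e G v′ k (y ⊞ v zero))
        ≡⟨ cong (λ s → s * e G v′ (suc k) y + W (v zero) * (sg k * e G v′ k (y ⊞ v zero))) (sg-suc k) ⟩
      - sg k * e G v′ (suc k) y + W (v zero) * (sg k * e G v′ k (y ⊞ v zero))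
        ≡⟨ solve 4 (λ s x w x′ → (:- s) :* x :+ w :* (s :* x′) := (:- s) :* (x :- w :* x′)) refl (sg k) (e G v′ (suc k) y) (W (v zero)) (e G v′ k (y ⊞ v zero)) ⟩
      - sg k * (e G v′ (suc k) y - W (v zero) * e G v′ k (y ⊞ v zero))
        ≡⟨ cong (_* e G v (suc k) y) (sym (sg-suc k)) ⟩
      sg (suc k) * e G v (suc k) y ∎

  sumOver : ∀ {n} → (Fin n → Fin q) → Subset n → Fin q
  sumOver v []          = 0ᶠ
  sumOver v (true ∷ I)  = v zero ⊞ sumOver (v ∘ suc) I
  sumOver v (false ∷ I) = sumOver (v ∘ suc) I

  subsetSum≡ : ∀ I → subsetSum F I ≡ sumOver id I
  subsetSum≡ = go id
    where
    add : ∀ {n} (v : Fin n → Fin q) (I : Subset n) → Fin n → Fin q → Fin q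
    add v I i acc = if does (i ∈? I) then v i ⊞ acc else acc
    shift : ∀ {n} (v : Fin (suc n) → Fin q) x (I : Subset n) →
      foldr (add v (x ∷ I)) 0ᶠ (tabulate suc) ≡ foldr (add (v ∘ suc) I) 0ᶠ (allFin n)
    shift v x I = trans (cong (foldr (add v (x ∷ I)) 0ᶠ) (sym (Listₚ.map-tabulate id suc))) (Listₚ.foldr-map (add v (x ∷ I)) suc 0ᶠ (allFin _))
    go : ∀ {n} (v : Fin n → Fin q) (I : Subset n) → foldr (add v I) 0ᶠ (allFin n) ≡ sumOver v I
    go v []          = refl
    go v (true ∷ I)  = cong (v zero ⊞_) (trans (shift v true I) (go (v ∘ suc) I))
    go v (false ∷ I) = trans (shift v false I) (go (v ∘ suc) I)

  δ₀ : Fin q → Carrier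
  δ₀ z = ν (δ z)

  Solution : ∀ {n} → (Fin n → Fin q) → ℕ → Fin q → Subset n → Set
  Solution v k y I = (∣ I ∣ ≡ k) × ((∀ i → i ∈ I → Sq (v i)) × (y ⊞ sumOver v I ≡ 0ᶠ))

  val-yes : ∀ {n} (v : Fin n → Fin q) k y I → Solution v k y I → val δ₀ v k y I ≡ 1#
  val-yes v zero    y [] (_ , _ , y+0≡0) = cong ν (trans (cong δ (trans (sym (K.+-identityʳ y)) y+0≡0)) K.δ-0)
  val-yes v (suc k) y [] (() , _)
  val-yes v zero    y (true ∷ I) (() , _)
  val-yes v (suc k) y (true ∷ I) (card , mem , eq) = trans (cong₂ _*_ (W-yes (mem zero here))
      (val-yes (v ∘ suc) k (y ⊞ v zero) I (ℕₚ.suc-injective card , (λ i i∈ → mem (suc i) (there i∈)) , trans (K.+-assoc _ _ _) eq)))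
    (*-identityˡ 1#)
  val-yes v zero    y (false ∷ I) (card , mem , eq) = val-yes (v ∘ suc) zero y I (card , (λ i i∈ → mem (suc i) (there i∈)) , eq)
  val-yes v (suc k) y (false ∷ I) (card , mem , eq) = val-yes (v ∘ suc) (suc k) y I (card , (λ i i∈ → mem (suc i) (there i∈)) , eq)

  val-no : ∀ {n} (v : Fin n → Fin q) k y I → ¬ Solution v k y I → val δ₀ v k y I ≡ 0#
  val-no v zero    y [] ¬sol = cong ν (K.δ-≢0 (λ y≡0 → ¬sol (refl , (λ _ ()) , trans (K.+-identityʳ y) y≡0)))
  val-no v (suc k) y [] ¬sol = refl
  val-no v zero    y (true ∷ I) ¬sol = refl
  val-no v (suc k) y (true ∷ I) ¬sol = by-cases (Sq? (v zero))
    where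
    by-cases : Dec (Sq (v zero)) → W (v zero) * val δ₀ (v ∘ suc) k (y ⊞ v zero) I ≡ 0#
    by-cases (no ¬s) = trans (cong (_* val δ₀ (v ∘ suc) k (y ⊞ v zero) I) (W-no ¬s)) (zeroˡ _)
    by-cases (yes s) = trans (cong (W (v zero) *_) (val-no (v ∘ suc) k (y ⊞ v zero) I
      (λ (card , mem , eq) → ¬sol (cong suc card , (λ { zero _ → s ; (suc i) (there i∈) → mem i i∈ }) , trans (sym (K.+-assoc _ _ _)) eq)))) (zeroʳ _)
  val-no v zero    y (false ∷ I) ¬sol = val-no (v ∘ suc) zero y I
    (λ (card , mem , eq) → ¬sol (card , (λ { (suc i) (there i∈) → mem i i∈ }) , eq))
  val-no v (suc k) y (false ∷ I) ¬sol = val-no (v ∘ suc) (suc k) y I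
    (λ (card , mem , eq) → ¬sol (card , (λ { (suc i) (there i∈) → mem i i∈ }) , eq))

  ν-length : {X : Set} (xs : List X) → ν (length xs) ≡ Σᴸ (λ _ → 1#) xs
  ν-length []       = refl
  ν-length (x ∷ xs) = trans (ν-+ 1 (length xs)) (cong (1# +_) (ν-length xs))

  ν-length-filter : {X : Set} {P : X → Set} (P? : ∀ x → Dec (P x)) (f : X → Carrier) →
    (∀ x → P x → f x ≡ 1#) → (∀ x → ¬ P x → f x ≡ 0#) → ∀ xs → ν (length (filter P? xs)) ≡ Σᴸ f xs
  ν-length-filter P? f f-yes f-no xs = trans (ν-length (filter P? xs))
    (trans (Σᴸ-filter P? (λ _ → 1#) xs) (Σᴸ-cong pointwise xs))
    where
    pointwise : ∀ x → (if does (P? x) then 1# else 0#) ≡ f x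
    pointwise x with P? x
    ... | yes p = sym (f-yes x p)
    ... | no ¬p = sym (f-no x ¬p)

  -- With the starting point - b, the delta at zero selects the sets with sum b.
  N-H≡e : ∀ k b → ν (N-H F k b) ≡ sg k * e δ₀ id k (⊟ b)
  N-H≡e k b = trans
    (ν-length-filter _ (val δ₀ id k (⊟ b))
      (λ I (card , mem , eq) → val-yes id k (⊟ b) I (card , mem , trans (cong (⊟ b ⊞_) (trans (sym (subsetSum≡ I)) eq)) (K.-‿inverseˡ b)))
      (λ I ¬p → val-no id k (⊟ b) I (λ (card , mem , eq) → ¬p (card , mem , trans (subsetSum≡ I) (solved I eq))))
      (allSubsets q))
    (sum-val δ₀ id k (⊟ b))
    where
    solved : ∀ I → ⊟ b ⊞ sumOver id I ≡ 0ᶠ → sumOver id I ≡ b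
    solved I eq = trans (sym (K.+-identityˡ _)) (trans (cong (_⊞ sumOver id I) (sym (K.-‿inverseʳ b)))
      (trans (K.+-assoc _ _ _) (trans (cong (b ⊞_) eq) (K.+-identityʳ b))))

-- The quadratic character, its sums, and the Gaussian periods.

module QuadraticCharacter (𝓐 : ℚ-Algebra) {q : ℕ} (F : FiniteField q)
  (2≢0 : FiniteField._+_ F (FiniteField.1# F) (FiniteField.1# F) ≢ FiniteField.0# F) where
  open ℚ-Algebra 𝓐
  open Solver using (solve; _:=_; _:+_; _:*_; _:-_; :-_; con)
  open ≡-Reasoning
  open SubsetSums 𝓐 F
  open Counting 𝓐 F
  open FiniteField F using () renaming (_+_ to infixl 6 _⊞_; _*_ to infixl 7 _⊠_; 0# to 0ᶠ; 1# to 1ᶠ; -_ to ⊟_)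
  open K using (Sq; Sq?; sq; δ; inv)
  open K.OddCharacteristic 2≢0

  2ℚ : ℚ
  2ℚ = 1ℚ ℚ.+ 1ℚ

  -- The quadratic character with value 0 at zero, where `χ F` has value -1. As an affine
  -- combination of `W` and `δ₀` it inherits its sum from the count of squares.
  X : Fin q → Carrier
  X x = (emb 2ℚ * W x + δ₀ x) - 1#

  δ₀-0 : δ₀ 0ᶠ ≡ 1#
  δ₀-0 = cong ν K.δ-0

  δ₀-≢0 : ∀ {x} → x ≢ 0ᶠ → δ₀ x ≡ 0#
  δ₀-≢0 x≢0 = cong ν (K.δ-≢0 x≢0)

  X-0 : X 0ᶠ ≡ 0#
  X-0 = trans (cong₂ (λ w d → (emb 2ℚ * w + d) - 1#) (cong ν K.sq-0) δ₀-0)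
    (solve 0 ((con 2ℚ :* con 0ℚ :+ con 1ℚ) :- con 1ℚ := con 0ℚ) refl)

  X-Sq : ∀ {x} → Sq x → X x ≡ 1#
  X-Sq s = trans (cong₂ (λ w d → (emb 2ℚ * w + d) - 1#) (W-yes s) (δ₀-≢0 (proj₁ s)))
    (solve 0 ((con 2ℚ :* con 1ℚ :+ con 0ℚ) :- con 1ℚ := con 1ℚ) refl)

  X-¬Sq : ∀ {x} → x ≢ 0ᶠ → ¬ Sq x → X x ≡ - 1#
  X-¬Sq x≢0 ¬s = trans (cong₂ (λ w d → (emb 2ℚ * w + d) - 1#) (W-no ¬s) (δ₀-≢0 x≢0))
    (solve 0 ((con 2ℚ :* con 0ℚ :+ con 0ℚ) :- con 1ℚ := :- con 1ℚ) refl)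

  W≡ : ∀ x → W x ≡ emb half * ((1# + X x) - δ₀ x)
  W≡ x = solve 2 (λ w d → w := con half :* ((con 1ℚ :+ ((con 2ℚ :* w :+ d) :- con 1ℚ)) :- d)) refl (W x) (δ₀ x)

  X-* : ∀ x y → X (x ⊠ y) ≡ X x * X y
  X-* x y = by-types (K.quadraticType x) (K.quadraticType y)
    where
    by-types : K.QuadraticType x → K.QuadraticType y → X (x ⊠ y) ≡ X x * X y
    by-types (K.isZero refl) _ = trans (trans (cong X (K.zeroˡ y)) X-0) (sym (trans (cong (_* X y) X-0) (zeroˡ _)))
    by-types _ (K.isZero refl) = trans (trans (cong X (K.zeroʳ x)) X-0) (sym (trans (cong (X x *_) X-0) (zeroʳ _)))
    by-types (K.isSquare s) (K.isSquare t) = trans (X-Sq (K.Sq-* s t)) (sym (trans (cong₂ _*_ (X-Sq s) (X-Sq t)) (*-identityˡ 1#)))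
    by-types (K.isSquare s) (K.isNonsquare y≢0 ¬t) = trans
      (X-¬Sq (K.*-≢0 (proj₁ s) y≢0) (λ st → ¬t (K.Sq-*-cancelˡ s st)))
      (sym (trans (cong₂ _*_ (X-Sq s) (X-¬Sq y≢0 ¬t)) (*-identityˡ _)))
    by-types (K.isNonsquare x≢0 ¬s) (K.isSquare t) = trans
      (X-¬Sq (K.*-≢0 x≢0 (proj₁ t)) (λ st → ¬s (K.Sq-*-cancelˡ t (subst Sq (K.*-comm x y) st))))
      (sym (trans (cong₂ _*_ (X-¬Sq x≢0 ¬s) (X-Sq t)) (*-identityʳ _)))
    by-types (K.isNonsquare x≢0 ¬s) (K.isNonsquare y≢0 ¬t) = trans
      (X-Sq (nonsquare-* x≢0 ¬s y≢0 ¬t))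
      (sym (trans (cong₂ _*_ (X-¬Sq x≢0 ¬s) (X-¬Sq y≢0 ¬t)) (solve 0 ((:- con 1ℚ) :* (:- con 1ℚ) := con 1ℚ) refl)))

  X² : ∀ {x} → x ≢ 0ᶠ → X x * X x ≡ 1#
  X² {x} x≢0 = trans (sym (X-* x x)) (X-Sq (K.Sq-square x≢0))

  X-inv : ∀ x → X (inv x) ≡ X x
  X-inv x = by-cases (x Finₚ.≟ 0ᶠ)
    where
    by-cases : Dec (x ≡ 0ᶠ) → X (inv x) ≡ X x
    by-cases (yes refl) = cong X K.inv-0
    by-cases (no x≢0) = begin
      X (inv x)                   ≡⟨ *-identityʳ _ ⟨
      X (inv x) * 1#              ≡⟨ cong (X (inv x) *_) (X² x≢0) ⟨
      X (inv x) * (X x * X x)     ≡⟨ *-assoc _ _ _ ⟨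
      (X (inv x) * X x) * X x     ≡⟨ cong (_* X x) (trans (sym (X-* (inv x) x)) (trans (cong X (K.inv-* x≢0)) (X-Sq K.Sq-1))) ⟩
      1# * X x                    ≡⟨ *-identityˡ _ ⟩
      X x                         ∎

  sum-lin : ∀ {n} a (f h : Fin n → Carrier) → sum (λ z → a * f z + h z) ≡ a * sum f + sum h
  sum-lin a f h = trans (∑-distrib-+ (λ z → a * f z) h) (cong (_+ sum h) (sym (*-distribˡ-sum a f)))

  sum-1 : sum {q} (λ _ → 1#) ≡ ν q
  sum-1 = trans (sum-ν {q} (λ _ → 1)) (cong ν (sumℕ-const1 q))

  sum-δ₀ : sum δ₀ ≡ 1#
  sum-δ₀ = trans (sum-ν δ) (cong ν K.sum-δ)

  sum-W : sum W ≡ emb half * (ν q - 1#)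
  sum-W = begin
    sum W                                             ≡⟨ sum-ν sq ⟩
    ν (sumℕ sq)                                       ≡⟨ solve 1 (λ s → s := con half :* ((con 2ℚ :* s :+ con 1ℚ) :- con 1ℚ)) refl (ν (sumℕ sq)) ⟩
    emb half * ((emb 2ℚ * ν (sumℕ sq) + 1#) - 1#)     ≡⟨ cong (λ x → emb half * (x - 1#)) (trans (cong (_+ 1#) (sym (ν-* 2 (sumℕ sq)))) (sym (ν-+ (2 ℕ.* sumℕ sq) 1))) ⟩
    emb half * (ν (2 ℕ.* sumℕ sq ℕ.+ 1) - 1#)         ≡⟨ cong (λ n → emb half * (ν n - 1#)) count-squares ⟩
    emb half * (ν q - 1#)                             ∎

  sum-X : sum X ≡ 0#
  sum-X = begin
    sum X
      ≡⟨ sum-cong-≗ (λ z → solve 2 (λ w d → (con 2ℚ :* w :+ d) :- con 1ℚ := con 2ℚ :* w :+ ((:- con 1ℚ) :* con 1ℚ :+ d)) refl (W z) (δ₀ z)) ⟩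
    sum (λ z → emb 2ℚ * W z + (- 1# * 1# + δ₀ z))
      ≡⟨ trans (sum-lin (emb 2ℚ) W (λ z → - 1# * 1# + δ₀ z)) (cong (emb 2ℚ * sum W +_) (sum-lin (- 1#) (λ _ → 1#) δ₀)) ⟩
    emb 2ℚ * sum W + (- 1# * sum {q} (λ _ → 1#) + sum δ₀)
      ≡⟨ cong₂ (λ a b → emb 2ℚ * a + b) sum-W (cong₂ (λ a b → - 1# * a + b) sum-1 sum-δ₀) ⟩
    emb 2ℚ * (emb half * (ν q - 1#)) + (- 1# * ν q + 1#)
      ≡⟨ solve 1 (λ n → con 2ℚ :* (con half :* (n :- con 1ℚ)) :+ ((:- con 1ℚ) :* n :+ con 1ℚ) := con 0ℚ) refl (ν q) ⟩
    0# ∎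

  sum-affine : ∀ x {c} → c ≢ 0ᶠ → (h : Fin q → Carrier) → sum (λ z → h (x ⊞ c ⊠ z)) ≡ sum h
  sum-affine x {c} c≢0 h = sum-reindex (λ z → x ⊞ c ⊠ z) (λ w → inv c ⊠ (⊟ x ⊞ w))
    (λ w → trans (cong (x ⊞_) (K.*-inv-cancelˡ c≢0 _)) (trans (sym (K.+-assoc _ _ _)) (trans (cong (_⊞ w) (K.-‿inverseʳ x)) (K.+-identityˡ w))))
    (λ z → trans (cong (inv c ⊠_) (trans (sym (K.+-assoc _ _ _)) (trans (cong (_⊞ c ⊠ z) (K.-‿inverseˡ x)) (K.+-identityˡ _)))) (K.inv-*-cancelˡ c≢0 z)) h

  private
    -- For z ≠ 0, multiply the argument of the second factor by z⁻¹, as χ(z) = χ(z⁻¹).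
    jacobi-term : ∀ x c z → X z * X (x ⊞ c ⊠ z) ≡ - X c * δ₀ z + X (c ⊞ x ⊠ inv z)
    jacobi-term x c z = by-cases (z Finₚ.≟ 0ᶠ)
      where
      by-cases : Dec (z ≡ 0ᶠ) → X z * X (x ⊞ c ⊠ z) ≡ - X c * δ₀ z + X (c ⊞ x ⊠ inv z)
      by-cases (yes refl) = trans (trans (cong (_* X (x ⊞ c ⊠ 0ᶠ)) X-0) (zeroˡ _))
        (sym (trans (cong₂ (λ d y → - X c * d + X y) δ₀-0 (trans (cong (λ i → c ⊞ x ⊠ i) K.inv-0) (trans (cong (c ⊞_) (K.zeroʳ x)) (K.+-identityʳ c))))
          (solve 1 (λ a → (:- a) :* con 1ℚ :+ a := con 0ℚ) refl (X c))))
      by-cases (no z≢0) = begin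
        X z * X (x ⊞ c ⊠ z)                  ≡⟨ cong (_* X (x ⊞ c ⊠ z)) (sym (X-inv z)) ⟩
        X (inv z) * X (x ⊞ c ⊠ z)            ≡⟨ sym (X-* _ _) ⟩
        X (inv z ⊠ (x ⊞ c ⊠ z))              ≡⟨ cong X (trans (K.distribˡ _ _ _) (trans (K.+-comm _ _) (cong₂ _⊞_
                                                  (trans (cong (inv z ⊠_) (K.*-comm c z)) (K.inv-*-cancelˡ z≢0 c)) (K.*-comm _ _)))) ⟩
        X (c ⊞ x ⊠ inv z)                    ≡⟨ solve 2 (λ a y → y := (:- a) :* con 0ℚ :+ y) refl (X c) _ ⟩
        - X c * 0# + X (c ⊞ x ⊠ inv z)       ≡⟨ cong (λ d → - X c * d + X (c ⊞ x ⊠ inv z)) (sym (δ₀-≢0 z≢0)) ⟩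
        - X c * δ₀ z + X (c ⊞ x ⊠ inv z)     ∎

    -- For x nonzero, z ↦ c + x * inv z permutes the field, the value `inv 0 = 0` included, and the
    -- sum of `X` is zero. For x = 0 the summand is constant.
    sum-inv-affine : ∀ x c → sum (λ z → X (c ⊞ x ⊠ inv z)) ≡ (ν q * δ₀ x) * X c
    sum-inv-affine x c = by-cases (x Finₚ.≟ 0ᶠ)
      where
      by-cases : Dec (x ≡ 0ᶠ) → sum (λ z → X (c ⊞ x ⊠ inv z)) ≡ (ν q * δ₀ x) * X c
      by-cases (yes refl) = begin
        sum (λ z → X (c ⊞ 0ᶠ ⊠ inv z))      ≡⟨ sum-cong-≗ {q} (λ z → trans (cong X (trans (cong (c ⊞_) (K.zeroˡ (inv z))) (K.+-identityʳ c))) (sym (*-identityʳ _))) ⟩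
        sum {q} (λ z → X c * 1#)            ≡⟨ sym (*-distribˡ-sum {q} (X c) (λ _ → 1#)) ⟩
        X c * sum {q} (λ _ → 1#)            ≡⟨ cong (X c *_) sum-1 ⟩
        X c * ν q                           ≡⟨ solve 2 (λ a n → a :* n := (n :* con 1ℚ) :* a) refl (X c) (ν q) ⟩
        (ν q * 1#) * X c                    ≡⟨ cong (λ d → (ν q * d) * X c) (sym δ₀-0) ⟩
        (ν q * δ₀ 0ᶠ) * X c                 ∎
      by-cases (no x≢0) = begin
        sum (λ z → X (c ⊞ x ⊠ inv z))       ≡⟨ sum-reindex inv inv K.inv-involutive K.inv-involutive (λ z → X (c ⊞ x ⊠ z)) ⟩
        sum (λ z → X (c ⊞ x ⊠ z))           ≡⟨ sum-affine c x≢0 X ⟩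
        sum X                               ≡⟨ sum-X ⟩
        0#                                  ≡⟨ solve 2 (λ a n → con 0ℚ := (n :* con 0ℚ) :* a) refl (X c) (ν q) ⟩
        (ν q * 0#) * X c                    ≡⟨ cong (λ d → (ν q * d) * X c) (sym (δ₀-≢0 x≢0)) ⟩
        (ν q * δ₀ x) * X c                  ∎

  -- After the substitution of `jacobi-term` the index z = 0 contributes a spurious `X c`, because
  -- `inv 0 = 0`; the first summand removes it.
  sum-jacobi : ∀ x c → sum (λ z → X z * X (x ⊞ c ⊠ z)) ≡ - X c * 1# + (ν q * δ₀ x) * X c
  sum-jacobi x c = trans (sum-cong-≗ (jacobi-term x c)) (trans (sum-lin (- X c) δ₀ (λ z → X (c ⊞ x ⊠ inv z)))
    (cong₂ (λ a b → - X c * a + b) sum-δ₀ (sum-inv-affine x c)))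

  sum-δ₀-at : (f : Fin q → Carrier) → sum (λ z → δ₀ z * f z) ≡ f 0ᶠ
  sum-δ₀-at f = trans (sum-single 0ᶠ (λ z → δ₀ z * f z) (λ z z≢0 → trans (cong (_* f z) (δ₀-≢0 z≢0)) (zeroˡ _)))
    (trans (cong (_* f 0ᶠ) δ₀-0) (*-identityˡ _))

  sum-X-δ₀ : ∀ x {c} → c ≢ 0ᶠ → sum (λ z → X z * δ₀ (x ⊞ c ⊠ z)) ≡ (X (⊟ 1ᶠ) * X x) * X c
  sum-X-δ₀ x {c} c≢0 = begin
    sum (λ z → X z * δ₀ (x ⊞ c ⊠ z))      ≡⟨ sum-single z₀ _ (λ z z≢z₀ → trans (cong (X z *_) (δ₀-≢0 (λ e → z≢z₀ (unique z e)))) (zeroʳ _)) ⟩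
    X z₀ * δ₀ (x ⊞ c ⊠ z₀)                ≡⟨ cong (X z₀ *_) (trans (cong δ₀ root) δ₀-0) ⟩
    X z₀ * 1#                             ≡⟨ *-identityʳ _ ⟩
    X z₀                                  ≡⟨ trans (X-* _ _) (cong₂ _*_ (X-* _ _) (X-inv c)) ⟩
    (X (⊟ 1ᶠ) * X x) * X c                ∎
    where
    -- This is - x / c, written as a product so that multiplicativity of `X` produces the factor
    -- `X (⊟ 1ᶠ)`.
    z₀ = (⊟ 1ᶠ ⊠ x) ⊠ inv c
    cz₀ : c ⊠ z₀ ≡ ⊟ 1ᶠ ⊠ x
    cz₀ = trans (cong (c ⊠_) (K.*-comm _ _)) (K.*-inv-cancelˡ c≢0 _)
    root : x ⊞ c ⊠ z₀ ≡ 0ᶠ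
    root = trans (cong₂ _⊞_ (sym (K.*-identityˡ x)) cz₀) (trans (sym (K.distribʳ x 1ᶠ (⊟ 1ᶠ))) (trans (cong (_⊠ x) (K.-‿inverseʳ 1ᶠ)) (K.zeroˡ x)))
    solution : ∀ w → x ⊞ w ≡ 0ᶠ → w ≡ ⊟ x
    solution w e = trans (sym (K.+-identityˡ w)) (trans (cong (_⊞ w) (sym (K.-‿inverseˡ x))) (trans (K.+-assoc _ _ _) (trans (cong (⊟ x ⊞_) e) (K.+-identityʳ _))))
    unique : ∀ z → x ⊞ c ⊠ z ≡ 0ᶠ → z ≡ z₀
    unique z e = trans (sym (K.inv-*-cancelˡ c≢0 z)) (trans (cong (inv c ⊠_) (trans (solution _ e) (sym (solution _ root)))) (K.inv-*-cancelˡ c≢0 z₀))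

  -- The Gaussian period of z: for an additive character with quadratic Gauss sum g it is Σ_{h∈H} ψ(hz).
  η : Carrier → Fin q → Carrier
  η g z = emb half * ((- 1# + X z * g) + ν q * δ₀ z)

  η-spherical : ∀ g → g * g ≡ X (⊟ 1ᶠ) * ν q → ∀ x c → sum (λ z → W z * η g (x ⊞ c ⊠ z)) ≡ η g c * η g x
  η-spherical g g² x c = by-cases (c Finₚ.≟ 0ᶠ)
    where
    by-cases : Dec (c ≡ 0ᶠ) → sum (λ z → W z * η g (x ⊞ c ⊠ z)) ≡ η g c * η g x
    -- The sum is |H| copies of `η g x`, and |H| = (q - 1) / 2 is the period at zero.
    by-cases (yes refl) = begin
      sum (λ z → W z * η g (x ⊞ 0ᶠ ⊠ z))
        ≡⟨ sum-cong-≗ (λ z → trans (cong (λ y → W z * η g y) (trans (cong (x ⊞_) (K.zeroˡ z)) (K.+-identityʳ x))) (*-comm _ _)) ⟩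
      sum (λ z → η g x * W z)
        ≡⟨ trans (sym (*-distribˡ-sum (η g x) W)) (cong (η g x *_) sum-W) ⟩
      η g x * (emb half * (ν q - 1#))
        ≡⟨ solve 3 (λ e n g → e :* (con half :* (n :- con 1ℚ)) := (con half :* ((:- con 1ℚ :+ con 0ℚ :* g) :+ n :* con 1ℚ)) :* e) refl (η g x) (ν q) g ⟩
      (emb half * ((- 1# + 0# * g) + ν q * 1#)) * η g x
        ≡⟨ cong₂ (λ a d → (emb half * ((- 1# + a * g) + ν q * d)) * η g x) (sym X-0) (sym δ₀-0) ⟩
      η g 0ᶠ * η g x ∎
    by-cases (no c≢0) = begin
      sum (λ z → W z * η g (y z))
        -- `W` and `η` are both affine in `X` and `δ₀`, so the product has nine monomials, and the
        -- sum of each one is known.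
        ≡⟨ sum-cong-≗ (λ z → trans (cong (_* η g (y z)) (W≡ z)) (expand (X z) (δ₀ z) (X (y z)) (δ₀ (y z)))) ⟩
      sum (λ z → emb half * emb half * t₁ z + 0#)
        ≡⟨ sum-lin (emb half * emb half) t₁ (λ _ → 0#) ⟩
      emb half * emb half * sum t₁ + sum {q} (λ _ → 0#)
        ≡⟨ cong₂ (λ a b → emb half * emb half * a + b) sum-t₁ (sum-replicate-zero q) ⟩
      emb half * emb half * (- 1# * ν q + (g * 0# + (n * 1# + (- 1# * 0# + (g * (- Xc * 1# + (n * d) * Xc) + (n * ((ε * Xx) * Xc) + (1# * 1# + (- g * Xx + (- n * d + 0#))))))))) + 0#
        ≡⟨ solve 6 (λ g n xc xx d ε → con half :* con half :* ((:- con 1ℚ) :* n :+ (g :* con 0ℚ :+ (n :* con 1ℚ :+ ((:- con 1ℚ) :* con 0ℚ :+ (g :* ((:- xc) :* con 1ℚ :+ (n :* d) :* xc) :+ (n :* ((ε :* xx) :* xc) :+ (con 1ℚ :* con 1ℚ :+ ((:- g) :* xx :+ ((:- n) :* d :+ con 0ℚ))))))))) :+ con 0ℚ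
              := con half :* con half :* (((:- con 1ℚ) :+ xc :* g) :* (((:- con 1ℚ)) :+ n :* d) :+ ((:- (xx :* g)) :+ (xc :* xx) :* (ε :* n)))) refl g n Xc Xx d ε ⟩
      emb half * emb half * ((- 1# + Xc * g) * (- 1# + n * d) + (- (Xx * g) + (Xc * Xx) * (ε * n)))
        -- The hypothesis on g turns χ(c) χ(x) χ(-1) q, which comes from `sum-X-δ₀`, into the
        -- missing g * g term; then the sum factors as a product of periods.
        ≡⟨ cong (λ s → emb half * emb half * ((- 1# + Xc * g) * (- 1# + n * d) + (- (Xx * g) + (Xc * Xx) * s))) (sym g²) ⟩
      emb half * emb half * ((- 1# + Xc * g) * (- 1# + n * d) + (- (Xx * g) + (Xc * Xx) * (g * g)))
        ≡⟨ solve 5 (λ g n xc xx d → con half :* con half :* ((:- con 1ℚ :+ xc :* g) :* (:- con 1ℚ :+ n :* d) :+ (:- (xx :* g) :+ (xc :* xx) :* (g :* g)))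
              := (con half :* ((:- con 1ℚ :+ xc :* g) :+ n :* con 0ℚ)) :* (con half :* ((:- con 1ℚ :+ xx :* g) :+ n :* d))) refl g n Xc Xx d ⟩
      (emb half * ((- 1# + Xc * g) + n * 0#)) * η g x
        ≡⟨ cong (λ d → (emb half * ((- 1# + Xc * g) + n * d)) * η g x) (sym (δ₀-≢0 c≢0)) ⟩
      η g c * η g x ∎
      where
      n = ν q
      Xc = X c
      Xx = X x
      d = δ₀ x
      ε = X (⊟ 1ᶠ)
      y : Fin q → Fin q
      y z = x ⊞ c ⊠ z
      t₁ : Fin q → Carrier
      -- The monomials are nested to the right and closed by `0#`, so that each application of
      -- `sum-lin` peels off one of them.
      t₁ z = - 1# * 1# + (g * X (y z) + (n * δ₀ (y z) + (- 1# * X z + (g * (X z * X (y z)) + (n * (X z * δ₀ (y z)) + (1# * δ₀ z + (- g * (δ₀ z * X (y z)) + (- n * (δ₀ z * δ₀ (y z)) + 0#))))))))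
      expand : ∀ a b p r → (emb half * ((1# + a) - b)) * (emb half * ((- 1# + p * g) + n * r)) ≡
        emb half * emb half * (- 1# * 1# + (g * p + (n * r + (- 1# * a + (g * (a * p) + (n * (a * r) + (1# * b + (- g * (b * p) + (- n * (b * r) + 0#))))))))) + 0#
      expand a b p r = solve 6 (λ g n a b p r → (con half :* ((con 1ℚ :+ a) :- b)) :* (con half :* ((:- con 1ℚ :+ p :* g) :+ n :* r)) :=
        con half :* con half :* ((:- con 1ℚ) :* con 1ℚ :+ (g :* p :+ (n :* r :+ ((:- con 1ℚ) :* a :+ (g :* (a :* p) :+ (n :* (a :* r) :+ (con 1ℚ :* b :+ ((:- g) :* (b :* p) :+ ((:- n) :* (b :* r) :+ con 0ℚ))))))))) :+ con 0ℚ) refl g n a b p r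
      step : ∀ a f h {s s′} → sum f ≡ s → sum h ≡ s′ → sum {q} (λ z → a * f z + h z) ≡ a * s + s′
      step a f h refl refl = sum-lin a f h
      y0 : y 0ᶠ ≡ x
      y0 = trans (cong (x ⊞_) (K.zeroʳ c)) (K.+-identityʳ x)
      sum-t₁ : sum t₁ ≡ - 1# * ν q + (g * 0# + (n * 1# + (- 1# * 0# + (g * (- Xc * 1# + (n * d) * Xc) + (n * ((ε * Xx) * Xc) + (1# * 1# + (- g * Xx + (- n * d + 0#))))))))
      sum-t₁ =
        step _ _ _ sum-1
        (step _ _ _ (trans (sum-affine x c≢0 X) sum-X)
        (step _ _ _ (trans (sum-affine x c≢0 δ₀) sum-δ₀)
        (step _ _ _ sum-X
        (step _ _ _ (sum-jacobi x c)
        (step _ _ _ (sum-X-δ₀ x c≢0)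
        (step _ _ _ sum-δ₀
        (step _ _ _ (trans (sum-δ₀-at (X ∘ y)) (cong X y0))
        (step _ _ _ (trans (sum-δ₀-at (δ₀ ∘ y)) (cong δ₀ y0))
        (sum-replicate-zero q)))))))))

  χ-Sq : ∀ {x} → Sq x → χ F x ≡ ℤ.+ 1
  χ-Sq {x} s = cong (λ t → if t then ℤ.+ 1 else ℤ.- (ℤ.+ 1)) (dec-true (Sq? x) s)

  χ-¬Sq : ∀ {x} → ¬ Sq x → χ F x ≡ ℤ.- (ℤ.+ 1)
  χ-¬Sq {x} ¬s = cong (λ t → if t then ℤ.+ 1 else ℤ.- (ℤ.+ 1)) (dec-false (Sq? x) ¬s)

  squares-half : (q ∸ 1) / 2 ≡ sumℕ sq
  squares-half = begin
    (q ∸ 1) / 2                            ≡⟨ cong (λ n → (n ∸ 1) / 2) (sym count-squares) ⟩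
    (2 ℕ.* sumℕ sq ℕ.+ 1 ∸ 1) / 2          ≡⟨ cong (_/ 2) (trans (ℕₚ.m+n∸n≡m (2 ℕ.* sumℕ sq) 1) (ℕₚ.*-comm 2 (sumℕ sq))) ⟩
    (sumℕ sq ℕ.* 2) / 2                    ≡⟨ m*n/n≡m (sumℕ sq) 2 ⟩
    sumℕ sq                                ∎

  q≡suc : ∃ λ n → q ≡ suc n
  q≡suc = 2 ℕ.* sumℕ sq , trans (sym count-squares) (ℕₚ.+-comm (2 ℕ.* sumℕ sq) 1)

  module Formula (k : ℕ) (b : Fin q) (b≢0 : b ≢ 0ᶠ) (r : Carrier) (r² : r * r ≡ X (⊟ 1ᶠ) * ν q) where

    -- The factor `X b` makes the period at j depend on χ(j) χ(b), the quantity that decides between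
    -- u and v in `tval`. It also cancels at - b, where the period becomes (-1 ± ε r) / 2 for every
    -- b.
    g₊ g₋ ε : Carrier
    g₊ = X b * r
    g₋ = - (X b * r)
    ε  = X (⊟ 1ᶠ)

    private
      g₊² : g₊ * g₊ ≡ ε * ν q
      g₊² = trans (solve 2 (λ x r → (x :* r) :* (x :* r) := (x :* x) :* (r :* r)) refl (X b) r)
        (trans (cong₂ _*_ (X² b≢0) r²) (*-identityˡ _))

      g₋² : g₋ * g₋ ≡ ε * ν q
      g₋² = trans (solve 1 (λ g → (:- g) :* (:- g) := g :* g) refl g₊) g₊²

      X-neg-b : X (⊟ b) * X b ≡ ε
      X-neg-b = begin
        X (⊟ b) * X b           ≡⟨ cong (λ x → X x * X b) (sym (-1*x≈-x b)) ⟩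
        X (⊟ 1ᶠ ⊠ b) * X b      ≡⟨ cong (_* X b) (X-* _ _) ⟩
        (ε * X b) * X b         ≡⟨ *-assoc _ _ _ ⟩
        ε * (X b * X b)         ≡⟨ cong (ε *_) (X² b≢0) ⟩
        ε * 1#                  ≡⟨ *-identityʳ ε ⟩
        ε                       ∎
        where open import Algebra.Properties.Ring K.ring using (-1*x≈-x)

      η₊-neg-b : η g₊ (⊟ b) ≡ emb half * (- 1# + ε * r)
      η₊-neg-b = trans (cong (λ d → emb half * ((- 1# + X (⊟ b) * g₊) + ν q * d)) (δ₀-≢0 (K.-‿≢0 b≢0)))
        (trans (solve 4 (λ x y r n → con half :* ((:- con 1ℚ :+ x :* (y :* r)) :+ n :* con 0ℚ) := con half :* (:- con 1ℚ :+ (x :* y) :* r)) refl (X (⊟ b)) (X b) r (ν q))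
               (cong (λ x → emb half * (- 1# + x * r)) X-neg-b))

      η₋-neg-b : η g₋ (⊟ b) ≡ emb half * (- 1# - ε * r)
      η₋-neg-b = trans (cong (λ d → emb half * ((- 1# + X (⊟ b) * g₋) + ν q * d)) (δ₀-≢0 (K.-‿≢0 b≢0)))
        (trans (solve 4 (λ x y r n → con half :* ((:- con 1ℚ :+ x :* (:- (y :* r))) :+ n :* con 0ℚ) := con half :* (:- con 1ℚ :- (x :* y) :* r)) refl (X (⊟ b)) (X b) r (ν q))
               (cong (λ x → emb half * (- 1# - x * r)) X-neg-b))

      periods-sum : ∀ z → ν q * δ₀ z ≡ (η g₊ z + η g₋ z) + 1#
      periods-sum z = solve 4 (λ n d x g → n :* d := (con half :* ((:- con 1ℚ :+ x :* g) :+ n :* d) :+ con half :* ((:- con 1ℚ :+ x :* (:- g)) :+ n :* d)) :+ con 1ℚ) refl (ν q) (δ₀ z) (X z) g₊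

    q*N : ν q * ν (N-H F k b) ≡ sg k * (e (η g₊) id k (⊟ b) + e (η g₋) id k (⊟ b)) + ν (((q ∸ 1) / 2) C k)
    q*N = begin
      ν q * ν (N-H F k b)
        ≡⟨ cong (ν q *_) (N-H≡e k b) ⟩
      ν q * (sg k * e δ₀ id k y)
        ≡⟨ solve 3 (λ n s x → n :* (s :* x) := s :* (n :* x)) refl (ν q) (sg k) (e δ₀ id k y) ⟩
      sg k * (ν q * e δ₀ id k y)
        ≡⟨ cong (sg k *_) (trans (e-linear periods-sum id k y) (cong (e (η g₊) id k y + e (η g₋) id k y +_) (e-const id k y))) ⟩
      sg k * (e (η g₊) id k y + e (η g₋) id k y + sg k * ν (sumℕ sq C k))
        ≡⟨ solve 3 (λ s x c → s :* (x :+ s :* c) := s :* x :+ (s :* s) :* c) refl (sg k) (e (η g₊) id k y + e (η g₋) id k y) (ν (sumℕ sq C k)) ⟩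
      sg k * (e (η g₊) id k y + e (η g₋) id k y) + (sg k * sg k) * ν (sumℕ sq C k)
        ≡⟨ cong (sg k * (e (η g₊) id k y + e (η g₋) id k y) +_) (trans (cong (_* ν (sumℕ sq C k)) (sg-square k)) (trans (*-identityˡ _) (cong (λ m → ν (m C k)) (sym squares-half)))) ⟩
      sg k * (e (η g₊) id k y + e (η g₋) id k y) + ν (((q ∸ 1) / 2) C k) ∎
      where y = ⊟ b

    module _ (t₊ t₋ : ℕ → Carrier) (tpow₊ tpow₋ : ℕ → ℕ → Carrier)
      (tpow₊-zero : ∀ j → tpow₊ j 0 ≡ 1#) (tpow₊-suc : ∀ j c → tpow₊ j (suc c) ≡ t₊ j * tpow₊ j c)
      (tpow₋-zero : ∀ j → tpow₋ j 0 ≡ 1#) (tpow₋-suc : ∀ j c → tpow₋ j (suc c) ≡ t₋ j * tpow₋ j c)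
      (t₊≡ : ∀ j → t₊ j ≡ - η g₊ (ι F j)) (t₋≡ : ∀ j → t₋ j ≡ - η g₋ (ι F j)) where

      A₊ A₋ : Carrier
      A₊ = Σᴸ (CycleIndex.cycleIndexTerm 𝓐 k t₊ tpow₊ tpow₊-zero tpow₊-suc) (cycleTypes k)
      A₋ = Σᴸ (CycleIndex.cycleIndexTerm 𝓐 k t₋ tpow₋ tpow₋-zero tpow₋-suc) (cycleTypes k)

      private
        k!≡suc : ∃ λ n → k ! ≡ suc n
        k!≡suc = ℕ.pred (k !) , sym (ℕₚ.suc-pred (k !) {{k ℕₚ.!≢0}})

        inverse-at : ∀ {m} → (∃ λ n → m ≡ suc n) → emb (recip m) * ν m ≡ 1#
        inverse-at (n , refl) = trans (*-comm _ _) (ν-*-recip n)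

        k!*e₊ : ν (k !) * e (η g₊) id k (⊟ b) ≡ (emb half * (- 1# + ε * r)) * A₊
        k!*e₊ = trans (Spherical.e≡cycleIndex (η g₊) (η-spherical g₊ g₊²) k t₊ tpow₊ tpow₊-zero tpow₊-suc t₊≡ (⊟ b)) (cong (_* A₊) η₊-neg-b)

        k!*e₋ : ν (k !) * e (η g₋) id k (⊟ b) ≡ (emb half * (- 1# - ε * r)) * A₋
        k!*e₋ = trans (Spherical.e≡cycleIndex (η g₋) (η-spherical g₋ g₋²) k t₋ tpow₋ tpow₋-zero tpow₋-suc t₋≡ (⊟ b)) (cong (_* A₋) η₋-neg-b)

        emb-coef : emb (coef q k) ≡ sg k * (emb half * (emb (recip q) * emb (recip (k !))))
        emb-coef = begin
          emb (sgn k ℚ.* recip (2 ℕ.* q ℕ.* (k !)))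
            ≡⟨ emb-* _ _ ⟩
          sg k * emb (recip (2 ℕ.* q ℕ.* (k !)))
            ≡⟨ cong (λ x → sg k * emb x) (trans (recip-* (2 ℕ.* q) (k !)) (cong (ℚ._* recip (k !)) (recip-* 2 q))) ⟩
          sg k * emb ((half ℚ.* recip q) ℚ.* recip (k !))
            ≡⟨ cong (sg k *_) (trans (emb-* _ _) (trans (cong (_* emb (recip (k !))) (emb-* _ _)) (*-assoc _ _ _))) ⟩
          sg k * (emb half * (emb (recip q) * emb (recip (k !)))) ∎

      formula : ν (N-H F k b) ≡ emb (mainTerm q k) - emb (coef q k) * ((1# - ε * r) * A₊ + (1# + ε * r) * A₋)
      formula = begin
        N
          ≡⟨ sym (trans (cong (_* N) (inverse-at q≡suc)) (*-identityˡ N)) ⟩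
        (iq * ν q) * N
          ≡⟨ trans (*-assoc _ _ _) (cong (iq *_) q*N) ⟩
        iq * (sg k * (e₊ + e₋) + c)
          ≡⟨ cong (λ x → iq * (sg k * x + c)) (sym (trans (cong (_* (e₊ + e₋)) (inverse-at k!≡suc)) (*-identityˡ _))) ⟩
        iq * (sg k * ((ik * ν (k !)) * (e₊ + e₋)) + c)
          ≡⟨ cong (λ x → iq * (sg k * x + c)) (trans (*-assoc _ _ _) (cong (ik *_) (trans (distribˡ _ _ _) (cong₂ _+_ k!*e₊ k!*e₋)))) ⟩
        iq * (sg k * (ik * ((emb half * (- 1# + ε * r)) * A₊ + (emb half * (- 1# - ε * r)) * A₋)) + c)
          ≡⟨ solve 7 (λ iq s ik εr a a′ c → iq :* (s :* (ik :* ((con half :* (:- con 1ℚ :+ εr)) :* a :+ (con half :* (:- con 1ℚ :- εr)) :* a′)) :+ c)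
               := iq :* c :- (s :* (con half :* (iq :* ik))) :* ((con 1ℚ :- εr) :* a :+ (con 1ℚ :+ εr) :* a′)) refl iq (sg k) ik (ε * r) A₊ A₋ c ⟩
        iq * c - (sg k * (emb half * (iq * ik))) * ((1# - ε * r) * A₊ + (1# + ε * r) * A₋)
          ≡⟨ cong₂ (λ x y → x - y * ((1# - ε * r) * A₊ + (1# + ε * r) * A₋)) (sym (emb-* _ _)) (sym emb-coef) ⟩
        emb (mainTerm q k) - emb (coef q k) * ((1# - ε * r) * A₊ + (1# + ε * r) * A₋) ∎
        where
        N = ν (N-H F k b)
        iq = emb (recip q)
        ik = emb (recip (k !))
        c = ν (((q ∸ 1) / 2) C k)
        e₊ = e (η g₊) id k (⊟ b)
        e₋ = e (η g₋) id k (⊟ b)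

    neg-η-zero : ∀ g → - η g 0ᶠ ≡ emb half * (1# - ν q)
    neg-η-zero g = trans (cong₂ (λ x d → - (emb half * ((- 1# + x * g) + ν q * d))) X-0 δ₀-0)
      (solve 2 (λ g n → :- (con half :* ((:- con 1ℚ :+ con 0ℚ :* g) :+ n :* con 1ℚ)) := con half :* (con 1ℚ :- n)) refl g (ν q))

    neg-η₊ : ∀ {x} → x ≢ 0ᶠ → - η g₊ x ≡ emb half * (1# - (X x * X b) * r)
    neg-η₊ {x} x≢0 = trans (cong (λ d → - (emb half * ((- 1# + X x * g₊) + ν q * d))) (δ₀-≢0 x≢0))
      (solve 4 (λ x y r n → :- (con half :* ((:- con 1ℚ :+ x :* (y :* r)) :+ n :* con 0ℚ)) := con half :* (con 1ℚ :- (x :* y) :* r)) refl (X x) (X b) r (ν q))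

    neg-η₋ : ∀ {x} → x ≢ 0ᶠ → - η g₋ x ≡ emb half * (1# + (X x * X b) * r)
    neg-η₋ {x} x≢0 = trans (cong (λ d → - (emb half * ((- 1# + X x * g₋) + ν q * d))) (δ₀-≢0 x≢0))
      (solve 4 (λ x y r n → :- (con half :* ((:- con 1ℚ :+ x :* (:- (y :* r))) :+ n :* con 0ℚ)) := con half :* (con 1ℚ :+ (x :* y) :* r)) refl (X x) (X b) r (ν q))

    -- Translates the comparison of integer characters in `tval` into the sign that multiplies r in
    -- the period. At nonzero arguments `χ F` and `X` have the same sign.
    χ-≡⇒X : ∀ {x} → x ≢ 0ᶠ → χ F x ≡ χ F b → X x * X b ≡ 1#
    χ-≡⇒X {x} x≢0 χx≡χb = by-cases (Sq? x) (Sq? b)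
      where
      by-cases : Dec (Sq x) → Dec (Sq b) → X x * X b ≡ 1#
      by-cases (yes s) (yes t) = trans (cong₂ _*_ (X-Sq s) (X-Sq t)) (*-identityˡ 1#)
      by-cases (yes s) (no ¬t) with () ← trans (sym (χ-Sq s)) (trans χx≡χb (χ-¬Sq ¬t))
      by-cases (no ¬s) (yes t) with () ← trans (sym (χ-¬Sq ¬s)) (trans χx≡χb (χ-Sq t))
      by-cases (no ¬s) (no ¬t) = trans (cong₂ _*_ (X-¬Sq x≢0 ¬s) (X-¬Sq b≢0 ¬t)) (solve 0 ((:- con 1ℚ) :* (:- con 1ℚ) := con 1ℚ) refl)

    χ-≢⇒X : ∀ {x} → x ≢ 0ᶠ → χ F x ≢ χ F b → X x * X b ≡ - 1#
    χ-≢⇒X {x} x≢0 χx≢χb = by-cases (Sq? x) (Sq? b)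
      where
      by-cases : Dec (Sq x) → Dec (Sq b) → X x * X b ≡ - 1#
      by-cases (yes s) (yes t) = ⊥-elim (χx≢χb (trans (χ-Sq s) (sym (χ-Sq t))))
      by-cases (yes s) (no ¬t) = trans (cong₂ _*_ (X-Sq s) (X-¬Sq b≢0 ¬t)) (*-identityˡ _)
      by-cases (no ¬s) (yes t) = trans (cong₂ _*_ (X-¬Sq x≢0 ¬s) (X-Sq t)) (*-identityʳ _)
      by-cases (no ¬s) (no ¬t) = ⊥-elim (χx≢χb (trans (χ-¬Sq ¬s) (sym (χ-¬Sq ¬t))))

-- The rings `ℚ[√ D ]` as ℚ-algebras.

fromℤ-neg : ∀ n → fromℤ (ℤ.- (ℤ.+ n)) ≡ ℚ.- fromℤ (ℤ.+ n)
fromℤ-neg zero    = refl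
fromℤ-neg (suc n) = refl

ℚ[√_]-algebra : ℤ → ℚ-Algebra
ℚ[√ D ]-algebra = record
  { Carrier = ℚ[√ D ]
  ; _+_ = _⊕_ ; _*_ = _⊗_ ; -_ = ⊝_ ; emb = embed
  ; isCommutativeRing = record
    { isRing = record
      { +-isAbelianGroup = record
        { isGroup = record
          { isMonoid = record
            { isSemigroup = record
              { isMagma = record { isEquivalence = isEquivalence ; ∙-cong = cong₂ _⊕_ }
              ; assoc = λ (a +√· b) (c +√· d) (e +√· f) → cong₂ _+√·_ (ℚₚ.+-assoc a c e) (ℚₚ.+-assoc b d f) }
            ; identity = (λ (a +√· b) → cong₂ _+√·_ (ℚₚ.+-identityˡ a) (ℚₚ.+-identityˡ b))
                       , (λ (a +√· b) → cong₂ _+√·_ (ℚₚ.+-identityʳ a) (ℚₚ.+-identityʳ b)) }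
          ; inverse = (λ (a +√· b) → cong₂ _+√·_ (ℚₚ.+-inverseˡ a) (ℚₚ.+-inverseˡ b))
                    , (λ (a +√· b) → cong₂ _+√·_ (ℚₚ.+-inverseʳ a) (ℚₚ.+-inverseʳ b))
          ; ⁻¹-cong = cong ⊝_ }
        ; comm = λ (a +√· b) (c +√· d) → cong₂ _+√·_ (ℚₚ.+-comm a c) (ℚₚ.+-comm b d) }
      ; *-cong = cong₂ _⊗_
      ; *-assoc = λ (a +√· b) (c +√· d) (e +√· f) → cong₂ _+√·_
          (solve 7 (λ D a b c d e f → (a :* c :+ D :* b :* d) :* e :+ D :* (a :* d :+ b :* c) :* f := a :* (c :* e :+ D :* d :* f) :+ D :* b :* (c :* f :+ d :* e)) refl (D ℚ./ 1) a b c d e f)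
          (solve 7 (λ D a b c d e f → (a :* c :+ D :* b :* d) :* f :+ (a :* d :+ b :* c) :* e := a :* (c :* f :+ d :* e) :+ b :* (c :* e :+ D :* d :* f)) refl (D ℚ./ 1) a b c d e f)
      ; *-identity = (λ (a +√· b) → cong₂ _+√·_
            (solve 3 (λ D a b → con 1ℚ :* a :+ D :* con 0ℚ :* b := a) refl (D ℚ./ 1) a b)
            (solve 2 (λ a b → con 1ℚ :* b :+ con 0ℚ :* a := b) refl a b))
          , (λ (a +√· b) → cong₂ _+√·_
            (solve 3 (λ D a b → a :* con 1ℚ :+ D :* b :* con 0ℚ := a) refl (D ℚ./ 1) a b)
            (solve 2 (λ a b → a :* con 0ℚ :+ b :* con 1ℚ := b) refl a b))
      ; distrib = (λ (a +√· b) (c +√· d) (e +√· f) → cong₂ _+√·_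
            (solve 7 (λ D a b c d e f → a :* (c :+ e) :+ D :* b :* (d :+ f) := (a :* c :+ D :* b :* d) :+ (a :* e :+ D :* b :* f)) refl (D ℚ./ 1) a b c d e f)
            (solve 6 (λ a b c d e f → a :* (d :+ f) :+ b :* (c :+ e) := (a :* d :+ b :* c) :+ (a :* f :+ b :* e)) refl a b c d e f))
          , (λ (a +√· b) (c +√· d) (e +√· f) → cong₂ _+√·_
            (solve 7 (λ D a b c d e f → (c :+ e) :* a :+ D :* (d :+ f) :* b := (c :* a :+ D :* d :* b) :+ (e :* a :+ D :* f :* b)) refl (D ℚ./ 1) a b c d e f)
            (solve 6 (λ a b c d e f → (c :+ e) :* b :+ (d :+ f) :* a := (c :* b :+ d :* a) :+ (e :* b :+ f :* a)) refl a b c d e f)) }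
    ; *-comm = λ (a +√· b) (c +√· d) → cong₂ _+√·_
        (solve 5 (λ D a b c d → a :* c :+ D :* b :* d := c :* a :+ D :* d :* b) refl (D ℚ./ 1) a b c d)
        (solve 4 (λ a b c d → a :* d :+ b :* c := c :* b :+ d :* a) refl a b c d) }
  ; emb-+ = λ x y → refl
  ; emb-* = λ x y → cong₂ _+√·_
      (solve 3 (λ D x y → x :* y := x :* y :+ D :* con 0ℚ :* con 0ℚ) refl (D ℚ./ 1) x y)
      (solve 2 (λ x y → con 0ℚ := x :* con 0ℚ :+ con 0ℚ :* y) refl x y)
  ; emb-neg = λ x → refl
  }
  where open ℚSolver.+-*-Solver

√D² : ∀ {D} → √D ⊗ √D ≡ embed {D} (fromℤ D)
√D² {D} = cong₂ _+√·_
  (solve 1 (λ D → con 0ℚ :* con 0ℚ :+ D :* con 1ℚ :* con 1ℚ := D) refl (D ℚ./ 1))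
  (solve 0 (con 0ℚ :* con 1ℚ :+ con 1ℚ :* con 0ℚ := con 0ℚ) refl)
  where open ℚSolver.+-*-Solver

tval-cases : ∀ {q} (F : FiniteField q) p {D} b (u v w : ℚ[√ D ]) j {x} →
  (p ∣ j → w ≡ x) → (¬ p ∣ j → χ F (ι F j) ≡ χ F b → u ≡ x) → (¬ p ∣ j → χ F (ι F j) ≢ χ F b → v ≡ x) →
  tval F p b u v w j ≡ x
tval-cases F p b u v w j div same diff with p ∣? j
... | yes p∣j = div p∣j
... | no p∤j with χ F (ι F j) ℤ.≟ χ F b
...   | yes e = same p∤j e
...   | no ¬e = diff p∤j ¬e

-- The formula in `ℚ[√ D ]` and its two cases.

module Main {p s q : ℕ} (prime : Prime p) (p%2≡1 : p % 2 ≡ 1) (q≡p^s : q ≡ p ^ s)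
  (F : FiniteField q) (k : ℕ) (b : Fin q) (b≢0 : b ≢ FiniteField.0# F) (D : ℤ) where

  open ℚ-Algebra ℚ[√ D ]-algebra using (1#; _+_; _*_; -_; _-_; ν; module Solver; *-identityˡ; emb-[1-n]/2)
  open Solver using (solve; _:=_; _:+_; _:*_; _:-_; :-_; con)
  open FieldTheory.Characteristic F {p} {s} prime q≡p^s
  2≢0 = 1+1≢0 p%2≡1
  open QuadraticCharacter ℚ[√ D ]-algebra F 2≢0 public using (X; X-Sq; X-¬Sq; module Formula)

  private
    h w : ℚ[√ D ]
    h = embed half
    w = wval D q

    w≡ : w ≡ h * (1# - ν q)
    w≡ = emb-[1-n]/2 q

  module _ (√D²≡ : √D * √D ≡ X (FiniteField.-_ F (FiniteField.1# F)) * ν q) where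
    open Formula k b b≢0 √D √D²≡

    private
      u v : ℚ[√ D ]
      u = h * (1# - √D)
      v = h * (1# + √D)

      -- If p divides j, the image of j is zero and w = (1 - q) / 2 is minus the period there.
      -- Otherwise u and v are minus the periods with χ(j) χ(b) equal to 1 and -1.
      t₊≡ : ∀ j → tval F p b u v w j ≡ - _
      t₊≡ j = tval-cases F p b u v w j
        (λ p∣j → trans w≡ (sym (trans (cong (λ x → - η₊ x) (∣⇒ι≡0 p∣j)) (neg-η-zero g₊))))
        (λ p∤j e → sym (trans (neg-η₊ (∤⇒ι≢0 p∤j)) (trans (cong (λ x → h * (1# - x * √D)) (χ-≡⇒X (∤⇒ι≢0 p∤j) e)) (cong (λ x → h * (1# - x)) (*-identityˡ √D)))))
        (λ p∤j e → sym (trans (neg-η₊ (∤⇒ι≢0 p∤j)) (trans (cong (λ x → h * (1# - x * √D)) (χ-≢⇒X (∤⇒ι≢0 p∤j) e)) (solve 2 (λ h r → h :* (con 1ℚ :- (:- con 1ℚ) :* r) := h :* (con 1ℚ :+ r)) refl h √D))))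
        where η₊ = QuadraticCharacter.η ℚ[√ D ]-algebra F 2≢0 g₊

      t₋≡ : ∀ j → tval F p b v u w j ≡ - _
      t₋≡ j = tval-cases F p b v u w j
        (λ p∣j → trans w≡ (sym (trans (cong (λ x → - η₋ x) (∣⇒ι≡0 p∣j)) (neg-η-zero g₋))))
        (λ p∤j e → sym (trans (neg-η₋ (∤⇒ι≢0 p∤j)) (trans (cong (λ x → h * (1# + x * √D)) (χ-≡⇒X (∤⇒ι≢0 p∤j) e)) (cong (λ x → h * (1# + x)) (*-identityˡ √D)))))
        (λ p∤j e → sym (trans (neg-η₋ (∤⇒ι≢0 p∤j)) (trans (cong (λ x → h * (1# + x * √D)) (χ-≢⇒X (∤⇒ι≢0 p∤j) e)) (solve 2 (λ h r → h :* (con 1ℚ :+ (:- con 1ℚ) :* r) := h :* (con 1ℚ :- r)) refl h √D))))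
        where η₋ = QuadraticCharacter.η ℚ[√ D ]-algebra F 2≢0 g₋

    -- Passing from `g₊` to `g₋` exchanges u and v, which gives the second `A`. Both parts of the
    -- theorem are this formula with `ε` set to 1 or -1.
    subset-sum-count : embed (ℤ.+ N-H F k b ℚ./ 1) ≡
      embed (mainTerm q k) - embed (coef q k) * ((1# - ε * √D) * A F p k b u v w + (1# + ε * √D) * A F p k b v u w)
    subset-sum-count = formula (tval F p b u v w) (tval F p b v u w)
      (λ j c → tval F p b u v w j ^^ c) (λ j c → tval F p b v u w j ^^ c)
      (λ _ → refl) (λ _ _ → refl) (λ _ → refl) (λ _ _ → refl) t₊≡ t₋≡

open import Data.Rational using (_/_)
open import Data.Integer using (+_)

theorem5p1 : (p s q : ℕ) → Prime p → p % 2 ≡ 1 → 1 ≤ s → q ≡ p ^ s →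
    (F : FiniteField q) → (k : ℕ) → 1 ≤ k → k ≤ (q ∸ 1) Data.Nat.DivMod./ 2 →
    (b : Fin q) → b ≢ FiniteField.0# F →
    ((p % 4 ≡ 1 ⊎ (p % 4 ≡ 3 × s % 2 ≡ 0)) →
    embed (+ N-H F k b Data.Rational./ 1) ≡ RHS₁ F p k b)
    × ((p % 4 ≡ 3 × s % 2 ≡ 1) →
    embed (+ N-H F k b Data.Rational./ 1) ≡ RHS₂ F p k b)
theorem5p1 p s q p-prime p%2≡1 _ q≡p^s F k _ _ b b≢0 = case₁ , case₂
  where
  module Case D = Main {p} {s} p-prime p%2≡1 q≡p^s F k b b≢0 D
  open FieldTheory.OddCharacteristic F (FieldTheory.Characteristic.1+1≢0 F {p} {s} p-prime q≡p^s p%2≡1)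

  case₁ : _ → _
  -- Here `ε` is 1, so D = q is the right square for `√D`.
  case₁ hyp = trans (Case.subset-sum-count (ℤ.+ q) (trans √D² (sym (trans (cong (_⊗ _) ε≡1) (*-identityˡ _)))))
    (cong (λ x → embed (mainTerm q k) ⊖ embed (coef q k) ⊗ ((1# ⊖ x) ⊗ A F p k b u v w ⊕ (1# ⊕ x) ⊗ A F p k b v u w))
      (trans (cong (_⊗ √D) ε≡1) (*-identityˡ √D)))
    where
    open ℚ-Algebra ℚ[√ ℤ.+ q ]-algebra using (1#; *-identityˡ)
    u = embed half ⊗ (1# ⊖ √D)
    v = embed half ⊗ (1# ⊕ √D)
    w = wval (ℤ.+ q) q
    q%4≡1 : p % 4 ≡ 1 ⊎ (p % 4 ≡ 3 × s % 2 ≡ 0) → q % 4 ≡ 1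
    q%4≡1 (inj₁ p%4≡1)          = trans (cong (_% 4) q≡p^s) (^-%4-1 p s p%4≡1)
    q%4≡1 (inj₂ (p%4≡3 , even)) = trans (cong (_% 4) q≡p^s) (proj₁ (^-%4-3 p s p%4≡3) even)
    ε≡1 = Case.X-Sq (ℤ.+ q) (≡1mod4⇒Sq[-1] (q%4≡1 hyp))

  case₂ : _ → _
  case₂ (p%4≡3 , odd) = trans (Case.subset-sum-count (ℤ.- ℤ.+ q) (trans √D² (sym (trans (cong (_⊗ _) ε≡-1) -1*νq))))
    -- Now `ε` is -1. It flips the signs of the outer factors but not those in u and v, which do not
    -- involve `ε`; hence the different sign pattern of `RHS₂`.
    (cong₂ (λ x y → embed (mainTerm q k) ⊖ embed (coef q k) ⊗ (x ⊗ A F p k b u v w ⊕ y ⊗ A F p k b v u w))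
      (trans (cong (λ x → 1# ⊖ x ⊗ √D) ε≡-1) (solve 1 (λ r → con 1ℚ :- (:- con 1ℚ) :* r := con 1ℚ :+ r) refl √D))
      (trans (cong (λ x → 1# ⊕ x ⊗ √D) ε≡-1) (solve 1 (λ r → con 1ℚ :+ (:- con 1ℚ) :* r := con 1ℚ :- r) refl √D)))
    where
    open ℚ-Algebra ℚ[√ ℤ.- ℤ.+ q ]-algebra using (1#; ν; module Solver)
    open Solver
    u = embed half ⊗ (1# ⊖ √D)
    v = embed half ⊗ (1# ⊕ √D)
    w = wval (ℤ.- ℤ.+ q) q
    q%4≡3 = trans (cong (_% 4) q≡p^s) (proj₂ (^-%4-3 p s p%4≡3) odd)
    ε≡-1 = Case.X-¬Sq (ℤ.- ℤ.+ q) (FieldTheory.-‿≢0 F (λ 1≡0 → FiniteField.0≢1 F (sym 1≡0))) (≡3mod4⇒¬Sq[-1] q%4≡3)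
    -1*νq : (⊝ 1#) ⊗ ν q ≡ embed (fromℤ (ℤ.- ℤ.+ q))
    -1*νq = trans (solve 1 (λ n → (:- con 1ℚ) :* n := :- n) refl (ν q)) (cong embed (sym (fromℤ-neg q)))
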